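{- For every integer $n\geq 10$, $$\varphi_{n}^{3}(2,1)=\binom{n-1}{2}-2,$$ where $\varphi_n^3(2,1)$ denotes the maximum number of arcs of a strong digraph on $n$ vertices that contains no directed cycle of length $2$ or $3$ and in which every vertex has out-degree at least $2$ and in-degree at least $1$.
   Context: All digraphs are finite and simple (no loops, no parallel arcs); $A(D)$ is the arc set of a digraph $D$. A digraph is strong (strongly connected) if every two vertices are mutually reachable by directed paths. A directed cycle of length $\ell$ is a list $y_0,\ldots,y_{\ell-1}$ of distinct vertices with arcs $(y_i,y_{i+1})$ for $0\le i\le \ell-2$ and $(y_{\ell-1},y_0)$. For $k\ge 2$, a digraph is $C_{\le k}$-free if it contains no directed cycle of length $\ell$ for any $\ell\in\{2,3,\ldots,k\}$ as a subdigraph. For positive integers $\xi,\zeta$, $D_n^k(\xi,\zeta)$ is the family of $C_{\le k}$-free strong digraphs on $n$ vertices in which every vertex has out-degree at least $\xi$ and in-degree at least $\zeta$, and $\varphi_n^k(\xi,\zeta)=\max\{|A(D)|: D\in D_n^k(\xi,\zeta)\}$, with the convention $\varphi_n^k(\xi,\zeta)=0$ if $D_n^k(\xi,\zeta)=\emptyset$. -}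

module Defs where

open import Data.Bool using (Bool; T)
open import Data.Fin using (Fin; zero; suc; inject₁; fromℕ)
open import Data.List using (List; length; filterᵇ; allFin; cartesianProduct)
open import Data.Nat using (ℕ; suc; _≤_; _≥_)
open import Data.Nat.Properties using (≤-antisym)
open import Data.Product using (∃; _×_; _,_; uncurry)
open import Data.Sum using (_⊎_; inj₁; inj₂)
open import Data.Empty using (⊥-elim)
open import Function.Definitions using (Injective)
open import Relation.Binary.Construct.Closure.ReflexiveTransitive using (Star)
open import Relation.Binary.PropositionalEquality using (_≡_; refl; sym; trans)
open import Relation.Nullary using (¬_)

-- The vertex set of a digraph on n vertices is taken to be Fin n.  A Boolean
-- adjacency matrix leaves no room for parallel arcs.
record Digraph (n : ℕ) : Set where
  field
    adj      : Fin n → Fin n → Bool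
    loopless : ∀ v → ¬ T (adj v v)

  Arc : Fin n → Fin n → Set
  Arc u v = T (adj u v)

  arcs : List (Fin n × Fin n)
  arcs = filterᵇ (uncurry adj) (cartesianProduct (allFin n) (allFin n))

  ∣A∣ : ℕ
  ∣A∣ = length arcs

  outDegree : Fin n → ℕ
  outDegree v = length (filterᵇ (λ w → adj v w) (allFin n))

  inDegree : Fin n → ℕ
  inDegree v = length (filterᵇ (λ u → adj u v) (allFin n))

  -- Star Arc u v is the type of directed walks from u to v, so ranging over
  -- all ordered pairs gives mutual reachability.
  Strong : Set
  Strong = ∀ u v → Star Arc u v

  -- The cycle y₀ , … , yₘ has length suc m.
  record IsDirectedCycle {m : ℕ} (y : Fin (suc m) → Fin n) : Set where
    field
      distinct : Injective _≡_ _≡_ y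
      step     : ∀ (i : Fin m) → Arc (y (inject₁ i)) (y (suc i))
      close    : Arc (y (fromℕ m)) (y zero)

  C≤_-Free : ℕ → Set
  C≤ k -Free = ∀ {m} → 2 ≤ suc m → suc m ≤ k →
               (y : Fin (suc m) → Fin n) → ¬ IsDirectedCycle y

-- Membership in the family D_n^k(ξ,ζ).
record InFamily {n : ℕ} (k ξ ζ : ℕ) (D : Digraph n) : Set where
  open Digraph D
  field
    free   : C≤ k -Free
    strong : Strong
    minOut : ∀ v → outDegree v ≥ ξ
    minIn  : ∀ v → inDegree v ≥ ζ

-- φ[ n , k ]⟨ ξ , ζ ⟩≡ m is the graph of the function φ_n^k(ξ,ζ): either m is
-- the maximum (attained, and an upper bound), or the family is empty and m is
-- the conventional value 0.
φ[_,_]⟨_,_⟩≡_ : (n k ξ ζ m : ℕ) → Set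
φ[ n , k ]⟨ ξ , ζ ⟩≡ m =
    ( (∃ λ (D : Digraph n) → InFamily k ξ ζ D × Digraph.∣A∣ D ≡ m)
    × (∀ (D : Digraph n) → InFamily k ξ ζ D → Digraph.∣A∣ D ≤ m) )
  ⊎ ( (∀ (D : Digraph n) → ¬ InFamily k ξ ζ D) × m ≡ 0 )

φ-unique : ∀ {n k ξ ζ m m′} →
           φ[ n , k ]⟨ ξ , ζ ⟩≡ m → φ[ n , k ]⟨ ξ , ζ ⟩≡ m′ → m ≡ m′
φ-unique (inj₁ ((D , p , refl) , b)) (inj₁ ((D′ , p′ , refl) , b′)) =
  ≤-antisym (b′ D p) (b D′ p′)
φ-unique (inj₁ ((D , p , _) , _)) (inj₂ (none , _)) = ⊥-elim (none D p)
φ-unique (inj₂ (none , _)) (inj₁ ((D , p , _) , _)) = ⊥-elim (none D p)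
φ-unique (inj₂ (_ , e)) (inj₂ (_ , e′)) = trans e (sym e′)

{-# OPTIONS --safe #-}
module Submission where

-- Write the number of nonadjacent pairs of a strong digraph without cycles of length 2
-- or 3 as order − 2 + excess; the claim is that the minimum excess is 3.  Growing a
-- strong induced subdigraph by ears never decreases the excess, and adding a vertex v
-- with k nonneighbours inside it costs at least k − 1.  Hence the excess is nonnegative.
--
-- If every vertex except z has out-degree at least 2, then excess + in-degree(z) ≥ 4.
-- Applied to a strong part with a single exit z, this gives excess at least 3 as soon as
-- some vertex has a unique nonneighbour (which is then a cut vertex) or there is a cut
-- vertex at all.  Otherwise every vertex has exactly two nonneighbours.  All paths from
-- N⁺(x) to N⁻(x) then pass through the two nonneighbours of x; counting the arcs out of
-- N⁺(x) forces a vertex x of out-degree 2, and for n ≥ 10 its neighbourhood contains a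
-- vertex with three nonneighbours.
--
-- The bound is attained by blowing up one vertex of a digraph of order 9 to a transitive
-- tournament.

open import Defs
open import Data.Bool using (Bool; true; false; T; _∧_; _∨_)
open import Data.Bool.ListAction using (any)
open import Data.Bool.Properties using (T?)
open import Data.Empty using (⊥; ⊥-elim)
open import Data.Fin using (Fin; zero; suc; toℕ; _≟_)
open import Data.Fin.Patterns
open import Data.Fin.Properties using (any?; all?)
open import Data.Fin.Subset using (Subset; _∈_; _∉_; _⊆_; _⊂_; Nonempty; ⊤)
open import Data.Fin.Subset.Induction using (⊂-wellFounded; ⊃-wellFounded)
open import Data.Fin.Subset.Properties using (_∈?_; _⊆?_; nonempty?; anySubset?; ⊆-antisym; ∈⊤)
open import Data.List as List using (List; []; _∷_; length; filterᵇ; cartesianProduct; map; _++_)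
open import Data.Nat using (ℕ; zero; suc; _+_; _*_; _∸_; _≤_; _<_; _≥_; z≤n; s≤s; _≤?_; _≡ᵇ_)
open import Data.Nat.Combinatorics using (_C_; nC1≡n; nCk+nC[k+1]≡[n+1]C[k+1])
open import Data.Nat.Induction using (<-wellFounded)
open import Data.Nat.Properties hiding (_≟_; _≤?_)
open import Data.Nat.Tactic.RingSolver using (solve)
open import Data.Product using (∃; _×_; _,_; proj₁; proj₂; uncurry)
open import Data.Sum using (_⊎_; inj₁; inj₂; [_,_]′)
open import Data.Vec using (tabulate)
open import Data.Vec.Properties using (lookup∘tabulate; []=⇒lookup; lookup⇒[]=)
open import Function using (_∘_; id; flip)
open import Induction.WellFounded using (Acc; acc)
open import Relation.Binary.Construct.Closure.ReflexiveTransitive using (Star; ε; _◅_; _◅◅_; gmap)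
open import Relation.Binary.PropositionalEquality using (_≡_; _≢_; refl; sym; trans; cong; cong₂; subst; subst₂; module ≡-Reasoning)
open import Relation.Nullary using (¬_; Dec; yes; no; does)
open import Relation.Nullary.Decidable using (¬?; _×-dec_; _⊎-dec_; _→-dec_; dec-true; decidable-stable; from-yes)
open import Relation.Unary using (Decidable)

open import Algebra.Properties.Semiring.Sum +-*-semiring using (sum; sum-cong-≗; ∑-distrib-+; ∑-comm; *-distribˡ-sum; *-distribʳ-sum)

-- Counting

-- Strong parts are the right objects for the excess, but the out-degree hypothesis is not inherited
-- by them: the vertex through which a part is left may lose out-arcs. Hence the induction exempts
-- one vertex `z` and trades its in-degree for excess. The trade works because, if `z` is the only
-- exit of a part and z → t leaves it, every u in the part with u → z is nonadjacent to t: u → t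
-- would be a second exit, and t → u would close a triangle. So the in-degree of the exit reappears
-- as nonneighbours of the next vertex attached. The case of exactly two nonneighbours everywhere is
-- the borderline: n nonadjacent pairs are excess 2, which the averaging and the growth estimates
-- cannot exclude, so it needs a structural argument. Excess 3 means n + 1 nonadjacent pairs, and
-- C(n,2) - (n + 1) = C(n - 1,2) - 2.

infixl 5 _⊞_
_⊞_ : ∀ {a b c d} → a ≤ b → c ≤ d → a + c ≤ b + d
_⊞_ = +-mono-≤

-- Linear arithmetic by certificates: l ≤ r is a nonnegative combination of
-- hypotheses and s the slack with which it implies the goal.
farkas : ∀ {l r a b} s → l ≤ r → a + r + s ≡ b + l → a ≤ b
farkas {l} {r} {a} {b} s l≤r eq = +-cancelʳ-≤ l a b (begin
  a + l      ≤⟨ +-monoʳ-≤ a l≤r ⟩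
  a + r      ≤⟨ m≤m+n (a + r) s ⟩
  a + r + s  ≡⟨ eq ⟩
  b + l      ∎)
  where open ≤-Reasoning

absurd-≤ : ∀ {l r} s → l ≤ r → l ≡ r + suc s → ⊥
absurd-≤ {l} {r} s l≤r eq = m+1+n≰m r (subst (_≤ r) eq l≤r)

sum-mono : ∀ {n} {f g : Fin n → ℕ} → (∀ i → f i ≤ g i) → sum f ≤ sum g
sum-mono {zero}  h = z≤n
sum-mono {suc n} h = h zero ⊞ sum-mono (h ∘ suc)

sum-<⇒∃< : ∀ {n} (f g : Fin n → ℕ) → sum f < sum g → ∃ λ i → f i < g i
sum-<⇒∃< f g lt with any? (λ i → suc (f i) ≤? g i)
... | yes i = i
... | no ¬i = ⊥-elim (<⇒≱ lt (sum-mono (λ i → ≮⇒≥ (λ h → ¬i (i , h)))))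

sum-zero : ∀ n → sum {n} (λ _ → 0) ≡ 0
sum-zero zero    = refl
sum-zero (suc n) = sum-zero n

[_] : ∀ {P : Set} → Dec P → ℕ
[ yes _ ] = 1
[ no  _ ] = 0

opaque
  #_ : ∀ {n} {P : Fin n → Set} → Decidable P → ℕ
  # P? = sum (λ u → [ P? u ])

[]-yes : ∀ {P : Set} {P? : Dec P} → P → [ P? ] ≡ 1
[]-yes {P? = yes _} p = refl
[]-yes {P? = no ¬p} p = ⊥-elim (¬p p)

[]-no : ∀ {P : Set} {P? : Dec P} → ¬ P → [ P? ] ≡ 0
[]-no {P? = yes p} ¬p = ⊥-elim (¬p p)
[]-no {P? = no _}  ¬p = refl

[]≤1 : ∀ {P : Set} (P? : Dec P) → [ P? ] ≤ 1
[]≤1 (yes _) = ≤-refl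
[]≤1 (no _)  = z≤n

[]-× : ∀ {P Q : Set} (P? : Dec P) (Q? : Dec Q) → [ P? ×-dec Q? ] ≡ [ P? ] * [ Q? ]
[]-× (yes _) (yes _) = refl
[]-× (yes _) (no _)  = refl
[]-× (no _)  _       = refl

opaque
  unfolding #_

  #-mono : ∀ {n} {P Q : Fin n → Set} {P? : Decidable P} {Q? : Decidable Q} →
           (∀ u → P u → Q u) → # P? ≤ # Q?
  #-mono {P? = P?} {Q?} f = sum-mono pointwise
    where
    pointwise : ∀ u → [ P? u ] ≤ [ Q? u ]
    pointwise u with P? u
    ... | no _  = z≤n
    ... | yes p = ≤-reflexive (sym ([]-yes (f u p)))

  #-cover : ∀ {n} {P Q R : Fin n → Set} {P? : Decidable P} {Q? : Decidable Q} {R? : Decidable R} →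
            (∀ u → P u → Q u ⊎ R u) → # P? ≤ # Q? + # R?
  #-cover {P? = P?} {Q?} {R?} f = ≤-trans (sum-mono pointwise)
      (≤-reflexive (∑-distrib-+ (λ u → [ Q? u ]) (λ u → [ R? u ])))
    where
    pointwise : ∀ u → [ P? u ] ≤ [ Q? u ] + [ R? u ]
    pointwise u with P? u
    ... | no _ = z≤n
    ... | yes p with f u p
    ...   | inj₁ q = ≤-trans (≤-reflexive (sym ([]-yes {P? = Q? u} q))) (m≤m+n _ _)
    ...   | inj₂ r = ≤-trans (≤-reflexive (sym ([]-yes {P? = R? u} r))) (m≤n+m _ _)

  #-disjoint : ∀ {n} {P Q R : Fin n → Set} {P? : Decidable P} {Q? : Decidable Q}
      {R? : Decidable R} →
               (∀ u → P u → R u) → (∀ u → Q u → R u) → (∀ u → P u → ¬ Q u) → # P? + # Q? ≤ # R?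
  #-disjoint {P? = P?} {Q?} {R?} f g d = ≤-trans
      (≤-reflexive (sym (∑-distrib-+ (λ u → [ P? u ]) (λ u → [ Q? u ])))) (sum-mono pointwise)
    where
    pointwise : ∀ u → [ P? u ] + [ Q? u ] ≤ [ R? u ]
    pointwise u with P? u | Q? u
    ... | no _  | no _  = z≤n
    ... | yes p | yes q = ⊥-elim (d u p q)
    ... | yes p | no _  = ≤-reflexive (sym ([]-yes {P? = R? u} (f u p)))
    ... | no _  | yes q = ≤-reflexive (sym ([]-yes {P? = R? u} (g u q)))

  #⇒∃ : ∀ {n} {P : Fin n → Set} {P? : Decidable P} → 1 ≤ # P? → ∃ P
  #⇒∃ {n} {P? = P?} h
    with sum-<⇒∃< (λ _ → 0) (λ u → [ P? u ]) (≤-trans (s≤s (≤-reflexive (sum-zero n))) h)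
  ... | u , lt with P? u
  ...   | yes p = u , p
  ...   | no _  = ⊥-elim (<-irrefl refl lt)

sum-δ : ∀ {n} (q : Fin n) (f : Fin n → ℕ) → sum (λ u → [ u ≟ q ] * f u) ≡ f q
sum-δ {suc n} zero f =
  trans (cong₂ _+_ (+-identityʳ (f zero)) (sum-zero n)) (+-identityʳ (f zero))
sum-δ {suc n} (suc q) f = trans (sum-cong-≗ step) (sum-δ q (f ∘ suc))
  where
  step : ∀ u → [ suc u ≟ suc q ] * f (suc u) ≡ [ u ≟ q ] * f (suc u)
  step u with u ≟ q
  ... | yes _ = refl
  ... | no  _ = refl

opaque
  unfolding #_

  #-≡ : ∀ {n} (q : Fin n) → # (_≟ q) ≡ 1
  #-≡ q = trans (sum-cong-≗ (λ u → sym (*-identityʳ [ u ≟ q ]))) (sum-δ q (λ _ → 1))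

∃⇒# : ∀ {n} {P : Fin n → Set} {P? : Decidable P} {q} → P q → 1 ≤ # P?
∃⇒# {P = P} {P?} {q} p = subst (_≤ # P?) (#-≡ q) (#-mono λ { _ refl → p })

-- Decidable subsets and sums over them

opaque
  ⟪_⟫ : ∀ {n} {P : Fin n → Set} → Decidable P → Subset n
  ⟪ P? ⟫ = tabulate (λ u → does (P? u))

  ∈⟪⟫⁺ : ∀ {n} {P : Fin n → Set} {P? : Decidable P} {u} → P u → u ∈ ⟪ P? ⟫
  ∈⟪⟫⁺ {P? = P?} {u} p = lookup⇒[]= u _ (trans (lookup∘tabulate (does ∘ P?) u) (dec-true (P? u) p))

  ∈⟪⟫⁻ : ∀ {n} {P : Fin n → Set} {P? : Decidable P} {u} → u ∈ ⟪ P? ⟫ → P u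
  ∈⟪⟫⁻ {P? = P?} {u} h with P? u | trans (sym (lookup∘tabulate (does ∘ P?) u)) ([]=⇒lookup h)
  ... | yes p | _  = p
  ... | no _  | ()

infixl 6 _⊕_ _⊖_

_⊕_ : ∀ {n} → Subset n → Fin n → Subset n
H ⊕ q = ⟪ (λ u → (u ∈? H) ⊎-dec (u ≟ q)) ⟫

_⊖_ : ∀ {n} → Subset n → Fin n → Subset n
H ⊖ q = ⟪ (λ u → (u ∈? H) ×-dec ¬? (u ≟ q)) ⟫

module _ {n : ℕ} {H : Subset n} {q : Fin n} where

  ∈⊕ˡ : ∀ {u} → u ∈ H → u ∈ H ⊕ q
  ∈⊕ˡ = ∈⟪⟫⁺ ∘ inj₁

  ∈⊕ʳ : q ∈ H ⊕ q
  ∈⊕ʳ = ∈⟪⟫⁺ (inj₂ refl)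

  ∈⊕⁻ : ∀ {u} → u ∈ H ⊕ q → u ∈ H ⊎ u ≡ q
  ∈⊕⁻ = ∈⟪⟫⁻

  ⊕⊆ : ∀ {G} → H ⊆ G → q ∈ G → H ⊕ q ⊆ G
  ⊕⊆ {G} h q∈ u∈ = [ h , (λ e → subst (_∈ G) (sym e) q∈) ]′ (∈⊕⁻ u∈)

  ∈⊖⁺ : ∀ {u} → u ∈ H → u ≢ q → u ∈ H ⊖ q
  ∈⊖⁺ a b = ∈⟪⟫⁺ (a , b)

  ∈⊖⁻ : ∀ {u} → u ∈ H ⊖ q → u ∈ H × u ≢ q
  ∈⊖⁻ = ∈⟪⟫⁻

  ⊖⊆ : H ⊖ q ⊆ H
  ⊖⊆ = proj₁ ∘ ∈⊖⁻

⊖-⊕ : ∀ {n} {H : Subset n} {q} → q ∈ H → (H ⊖ q) ⊕ q ≡ H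
⊖-⊕ {H = H} {q} q∈ = ⊆-antisym (⊕⊆ ⊖⊆ q∈) back
  where
  back : H ⊆ (H ⊖ q) ⊕ q
  back {u} u∈ with u ≟ q
  ... | yes refl = ∈⊕ʳ
  ... | no u≢q   = ∈⊕ˡ (∈⊖⁺ u∈ u≢q)

card : ∀ {n} → Subset n → ℕ
card H = # (_∈? H)

opaque
  ∑∈ : ∀ {n} → Subset n → (Fin n → ℕ) → ℕ
  ∑∈ H f = sum (λ u → [ u ∈? H ] * f u)

module _ {n : ℕ} (H : Subset n) where

  opaque
    unfolding ∑∈ #_

    ∑∈-+ : ∀ f g → ∑∈ H (λ u → f u + g u) ≡ ∑∈ H f + ∑∈ H g
    ∑∈-+ f g = trans (sum-cong-≗ (λ u → *-distribˡ-+ [ u ∈? H ] (f u) (g u)))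
        (∑-distrib-+ (λ u → [ u ∈? H ] * f u) (λ u → [ u ∈? H ] * g u))

    ∑∈-mono : ∀ {f g} → (∀ u → u ∈ H → f u ≤ g u) → ∑∈ H f ≤ ∑∈ H g
    ∑∈-mono {f} {g} h = sum-mono pointwise
      where
      pointwise : ∀ u → [ u ∈? H ] * f u ≤ [ u ∈? H ] * g u
      pointwise u with u ∈? H
      ... | yes p = +-mono-≤ (h u p) ≤-refl
      ... | no _  = ≤-refl

    ∑∈-cong : ∀ {f g} → (∀ u → u ∈ H → f u ≡ g u) → ∑∈ H f ≡ ∑∈ H g
    ∑∈-cong h = ≤-antisym (∑∈-mono (λ u p → ≤-reflexive (h u p)))
        (∑∈-mono (λ u p → ≤-reflexive (sym (h u p))))

    ∑∈-const : ∀ k → ∑∈ H (λ _ → k) ≡ card H * k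
    ∑∈-const k = sym (*-distribʳ-sum k (λ u → [ u ∈? H ]))

    ∑∈-# : ∀ {P : Fin n → Set} (P? : Decidable P) → ∑∈ H (λ u → [ P? u ]) ≡ #
        (λ u → (u ∈? H) ×-dec P? u)
    ∑∈-# P? = sum-cong-≗ (λ u → sym ([]-× (u ∈? H) (P? u)))

    ∑∈-⊕ : ∀ {q} f → q ∉ H → ∑∈ (H ⊕ q) f ≡ ∑∈ H f + f q
    ∑∈-⊕ {q} f q∉ = trans (sum-cong-≗ pointwise)
        (trans (∑-distrib-+ (λ u → [ u ∈? H ] * f u) (λ u → [ u ≟ q ] * f u))
            (cong (∑∈ H f +_) (sum-δ q f)))
      where
      pointwise : ∀ u → [ u ∈? H ⊕ q ] * f u ≡ [ u ∈? H ] * f u + [ u ≟ q ] * f u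
      pointwise u with u ∈? H | u ≟ q
      ... | yes p | yes refl = ⊥-elim (q∉ p)
      ... | yes p | no _     = trans (cong (_* f u) ([]-yes {P? = u ∈? H ⊕ q} (∈⊕ˡ p)))
          (sym (+-identityʳ _))
      ... | no _  | yes refl = cong (_* f u) ([]-yes {P? = u ∈? H ⊕ q} ∈⊕ʳ)
      ... | no p  | no e     = cong (_* f u) ([]-no {P? = u ∈? H ⊕ q} ([ p , e ]′ ∘ ∈⊕⁻))

card-∑∈ : ∀ {n} (H : Subset n) → card H ≡ ∑∈ H (λ _ → 1)
card-∑∈ H = sym (trans (∑∈-const H 1) (*-identityʳ _))

card-⊕ : ∀ {n} {H : Subset n} {q} → q ∉ H → card (H ⊕ q) ≡ card H + 1
card-⊕ {H = H} {q} q∉ = trans (card-∑∈ (H ⊕ q))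
    (trans (∑∈-⊕ H (λ _ → 1) q∉) (cong (_+ 1) (sym (card-∑∈ H))))

card-mono : ∀ {n} {H K : Subset n} → H ⊆ K → card H ≤ card K
card-mono {H = H} {K} h = #-mono (λ _ → h)

∑∈-comm : ∀ {n} (H K : Subset n) (f : Fin n → Fin n → ℕ) →
          ∑∈ H (λ u → ∑∈ K (f u)) ≡ ∑∈ K (λ v → ∑∈ H (λ u → f u v))
∑∈-comm {n} H K f = trans (expand H K f) (trans (∑-comm (λ u v → [ u ∈? H ] * ([ v ∈? K ] * f u v)))
  (trans (sum-cong-≗ (λ v → sum-cong-≗ (λ u → swap [ u ∈? H ] [ v ∈? K ] (f u v))))
         (sym (expand K H (λ v u → f u v)))))
  where
  opaque
    unfolding ∑∈
    expand : (H K : Subset n) (f : Fin n → Fin n → ℕ) →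
             ∑∈ H (λ u → ∑∈ K (f u)) ≡ sum (λ u → sum (λ v → [ u ∈? H ] * ([ v ∈? K ] * f u v)))
    expand H K f = sum-cong-≗ (λ u → *-distribˡ-sum [ u ∈? H ] (λ v → [ v ∈? K ] * f u v))
  swap : (a b c : ℕ) → a * (b * c) ≡ b * (a * c)
  swap a b c = trans (sym (*-assoc a b c)) (trans (cong (_* c) (*-comm a b)) (*-assoc b a c))

-- Digraphs without cycles of length 2 and 3

module ShortCycleFree {n : ℕ} (D : Digraph n)
  (no2 : ∀ {u v} → Digraph.Arc D u v → ¬ Digraph.Arc D v u)
  (no3 : ∀ {u v w} → Digraph.Arc D u v → Digraph.Arc D v w → ¬ Digraph.Arc D w u) where

  open Digraph D using (adj; loopless)

  infix 4 _⟶_ _⟶?_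

  _⟶_ : Fin n → Fin n → Set
  u ⟶ v = T (adj u v)

  _⟶?_ : ∀ u v → Dec (u ⟶ v)
  u ⟶? v = T? (adj u v)

  Apart : Fin n → Fin n → Set
  Apart u v = u ≢ v × ¬ (u ⟶ v) × ¬ (v ⟶ u)

  apart? : ∀ u v → Dec (Apart u v)
  apart? u v = ¬? (u ≟ v) ×-dec ¬? (u ⟶? v) ×-dec ¬? (v ⟶? u)

  Apart-sym : ∀ {u v} → Apart u v → Apart v u
  Apart-sym (a , b , c) = a ∘ sym , c , b

  data Adjacency (u v : Fin n) : Set where
    out  : u ⟶ v → Adjacency u v
    inn  : v ⟶ u → Adjacency u v
    none : Apart u v → Adjacency u v

  adjacency : ∀ {u v} → u ≢ v → Adjacency u v
  adjacency {u} {v} u≢v with u ⟶? v | v ⟶? u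
  ... | yes a | _     = out a
  ... | no _  | yes b = inn b
  ... | no a  | no b  = none (u≢v , a , b)

  ⟶⇒≢ : ∀ {u v} → u ⟶ v → u ≢ v
  ⟶⇒≢ a refl = loopless _ a

  ∈∉⇒≢ : ∀ {u v} {H : Subset n} → u ∈ H → v ∉ H → u ≢ v
  ∈∉⇒≢ a b refl = b a

  -- Nonneighbours, degrees and their counting identities

  miss outd ind : Fin n → Subset n → ℕ
  miss q H = # (λ u → (u ∈? H) ×-dec apart? q u)
  outd q H = # (λ u → (u ∈? H) ×-dec (q ⟶? u))
  ind  q H = # (λ u → (u ∈? H) ×-dec (u ⟶? q))

  gaps arcsIn : Subset n → ℕ
  gaps   H = ∑∈ H (λ u → miss u H)
  arcsIn H = ∑∈ H (λ u → outd u H)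

  miss-⊕ : ∀ {H q} u → q ∉ H → miss u (H ⊕ q) ≡ miss u H + [ apart? u q ]
  miss-⊕ {H} {q} u q∉ = trans (sym (∑∈-# (H ⊕ q) (apart? u)))
    (trans (∑∈-⊕ H (λ v → [ apart? u v ]) q∉) (cong (_+ [ apart? u q ]) (∑∈-# H (apart? u))))

  gaps-⊕ : ∀ {H q} → q ∉ H → gaps (H ⊕ q) ≡ gaps H + 2 * miss q H
  gaps-⊕ {H} {q} q∉ = trans (∑∈-⊕ H (λ u → miss u (H ⊕ q)) q∉)
      (trans (cong₂ _+_ old new) (arith (gaps H) (miss q H)))
    where
    symm : ∀ u → [ apart? u q ] ≡ [ apart? q u ]
    symm u with apart? q u
    ... | yes a = []-yes (Apart-sym a)
    ... | no ¬a = []-no (¬a ∘ Apart-sym)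
    old : ∑∈ H (λ u → miss u (H ⊕ q)) ≡ gaps H + miss q H
    old = trans (∑∈-cong H (λ u _ → miss-⊕ u q∉))
        (trans (∑∈-+ H (λ u → miss u H) (λ u → [ apart? u q ]))
      (cong (gaps H +_) (trans (∑∈-cong H (λ u _ → symm u)) (∑∈-# H (apart? q)))))
    new : miss q (H ⊕ q) ≡ miss q H + 0
    new = trans (miss-⊕ q q∉) (cong (miss q H +_) ([]-no (λ a → proj₁ a refl)))
    arith : ∀ g m → (g + m) + (m + 0) ≡ g + 2 * m
    arith g m = solve (g ∷ m ∷ [])

  miss-mono : ∀ {H K} q → H ⊆ K → miss q H ≤ miss q K
  miss-mono q h = #-mono λ { _ (a , b) → h a , b }

  ind-mono : ∀ {H K} q → H ⊆ K → ind q H ≤ ind q K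
  ind-mono q h = #-mono λ { _ (a , b) → h a , b }

  outd-mono : ∀ {H K} q → H ⊆ K → outd q H ≤ outd q K
  outd-mono q h = #-mono λ { _ (a , b) → h a , b }

  degrees-sum : ∀ {H q} (f : Fin n → ℕ) →
                (∀ u → u ∈ H → [ q ⟶? u ] + [ u ⟶? q ] + [ apart? q u ] + f u ≡ 1) →
                outd q H + ind q H + miss q H + ∑∈ H f ≡ card H
  degrees-sum {H} {q} f h = trans (sym (trans (∑∈-+ H _ f) (cong (_+ ∑∈ H f) (trans (∑∈-+ H _ _)
    (cong₂ _+_ (trans (∑∈-+ H _ _) (cong₂ _+_ (∑∈-# H (q ⟶?_)) (∑∈-# H (_⟶? q))))
        (∑∈-# H (apart? q)))))))
    (trans (∑∈-cong H h) (sym (card-∑∈ H)))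

  trichotomy : ∀ {u v} → u ≢ v → [ u ⟶? v ] + [ v ⟶? u ] + [ apart? u v ] ≡ 1
  trichotomy {u} {v} u≢v with adjacency u≢v
  ... | out a  rewrite []-yes {P? = u ⟶? v} a | []-no {P? = v ⟶? u} (no2 a)
      | []-no {P? = apart? u v} (λ x → proj₁ (proj₂ x) a) = refl
  ... | inn a  rewrite []-yes {P? = v ⟶? u} a | []-no {P? = u ⟶? v} (no2 a)
      | []-no {P? = apart? u v} (λ x → proj₂ (proj₂ x) a) = refl
  ... | none a rewrite []-yes {P? = apart? u v} a | []-no {P? = u ⟶? v} (proj₁ (proj₂ a))
      | []-no {P? = v ⟶? u} (proj₂ (proj₂ a)) = refl

  degrees-∉ : ∀ {H q} → q ∉ H → outd q H + ind q H + miss q H ≡ card H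
  degrees-∉ {H} {q} q∉ = trans (sym (trans (cong (outd q H + ind q H + miss q H +_)
      (trans (∑∈-const H 0) (*-zeroʳ (card H)))) (+-identityʳ _)))
    (degrees-sum (λ _ → 0) (λ u u∈ → trans (+-identityʳ _) (trichotomy (∈∉⇒≢ u∈ q∉ ∘ sym))))

  degrees-∈ : ∀ {H q} → q ∈ H → outd q H + ind q H + miss q H + 1 ≡ card H
  degrees-∈ {H} {q} q∈ = trans (cong (outd q H + ind q H + miss q H +_) (sym single))
      (degrees-sum (λ u → [ u ≟ q ]) pointwise)
    where
    single : ∑∈ H (λ u → [ u ≟ q ]) ≡ 1
    single = trans (∑∈-# H (_≟ q)) (≤-antisym (≤-trans (#-mono (λ _ → proj₂)) (≤-reflexive (#-≡ q)))
        (∃⇒# (q∈ , refl)))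
    pointwise : ∀ u → u ∈ H → [ q ⟶? u ] + [ u ⟶? q ] + [ apart? q u ] + [ u ≟ q ] ≡ 1
    pointwise u _ with u ≟ q
    ... | no u≢q = trans (+-identityʳ _) (trichotomy (u≢q ∘ sym))
    ... | yes refl rewrite []-no {P? = q ⟶? q} (loopless q)
        | []-no {P? = apart? q q} (λ a → proj₁ a refl) = refl

  -- Sum of `degrees-∈` over `H`: every arc is counted at its tail and again at its head.
  arcs-gaps : ∀ H → 2 * arcsIn H + gaps H + card H ≡ card H * card H
  arcs-gaps H = trans (sym counted) (trans (∑∈-cong H (λ u → degrees-∈)) (∑∈-const H (card H)))
    where
    reverse : ∑∈ H (λ u → ind u H) ≡ arcsIn H
    reverse = trans (∑∈-cong H (λ u _ → sym (∑∈-# H (_⟶? u))))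
      (trans (∑∈-comm H H (λ u v → [ v ⟶? u ])) (∑∈-cong H (λ u _ → ∑∈-# H (u ⟶?_))))
    arith : ∀ a g c → a + a + g + c ≡ 2 * a + g + c
    arith a g c = solve (a ∷ g ∷ c ∷ [])
    counted : ∑∈ H (λ u → outd u H + ind u H + miss u H + 1) ≡ 2 * arcsIn H + gaps H + card H
    counted = trans (∑∈-+ H _ _) (trans (cong₂ _+_ (trans (∑∈-+ H _ _) (cong (_+ gaps H)
      (trans (∑∈-+ H _ _) (cong (arcsIn H +_) reverse)))) (sym (card-∑∈ H)))
          (arith (arcsIn H) (gaps H) (card H)))

  -- Strong connectivity through closed sets

  Closed : Subset n → Subset n → Set
  Closed H X = ∀ u v → u ∈ X → v ∈ H → u ⟶ v → v ∈ X

  -- The subdigraph induced by H is strongly connected, in cut form.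
  Strong : Subset n → Set
  Strong H = ∀ X → X ⊆ H → Nonempty X → Closed H X → H ⊆ X

  closed? : ∀ H X → Dec (Closed H X)
  closed? H X = all? λ u → all? λ v → (u ∈? X) →-dec (v ∈? H) →-dec (u ⟶? v) →-dec (v ∈? X)

  leaving : ∀ {H X} → ¬ Closed H X → ∃ λ u → ∃ λ v → u ∈ X × v ∈ H × v ∉ X × u ⟶ v
  leaving {H} {X} ¬c with any? (λ u → any? (λ v → (u ∈? X) ×-dec (v ∈? H) ×-dec ¬? (v ∈? X) ×-dec
      (u ⟶? v)))
  ... | yes w = w
  ... | no ¬w = ⊥-elim (¬c λ u v a b c → decidable-stable (v ∈? X)
      (λ v∉ → ¬w (u , v , a , b , v∉ , c)))

  ⊈⇒∃ : ∀ {H X : Subset n} → ¬ (H ⊆ X) → ∃ λ v → v ∈ H × v ∉ X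
  ⊈⇒∃ {H} {X} ¬h with any? (λ v → (v ∈? H) ×-dec ¬? (v ∈? X))
  ... | yes w = w
  ... | no ¬w = ⊥-elim (¬h (λ {v} v∈ → decidable-stable (v ∈? X) (λ v∉ → ¬w (v , v∈ , v∉))))

  escape : ∀ {H X v} → Strong H → X ⊆ H → Nonempty X → v ∈ H → v ∉ X →
           ∃ λ u → ∃ λ w → u ∈ X × w ∈ H × w ∉ X × u ⟶ w
  escape {H} {X} s X⊆ ne v∈ v∉ = leaving (λ c → v∉ (s X X⊆ ne c v∈))

  enter : ∀ {H X v} → Strong H → X ⊆ H → Nonempty X → v ∈ H → v ∉ X →
          ∃ λ u → ∃ λ w → u ∈ H × u ∉ X × w ∈ X × u ⟶ w
  enter {H} {X} {v} s X⊆ (x , x∈) v∈ v∉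
    with escape {X = ⟪ (λ u → (u ∈? H) ×-dec ¬? (u ∈? X)) ⟫} {v = x} s (proj₁ ∘ ∈⟪⟫⁻)
        (v , ∈⟪⟫⁺ (v∈ , v∉)) (X⊆ x∈) (λ h → proj₂ (∈⟪⟫⁻ h) x∈)
  ... | u , w , u∈ , w∈ , w∉ , a =
    u , w , proj₁ (∈⟪⟫⁻ u∈) , proj₂ (∈⟪⟫⁻ u∈) , decidable-stable (w ∈? X)
        (λ h → w∉ (∈⟪⟫⁺ (w∈ , h))) , a

  Split : Subset n → Set
  Split H = ∃ λ X → X ⊆ H × Nonempty X × Closed H X × ∃ λ v → v ∈ H × v ∉ X

  strong-or-split : ∀ H → Strong H ⊎ Split H
  strong-or-split H with anySubset? (λ X → (X ⊆? H) ×-dec nonempty? X ×-dec closed? H X ×-dec ¬?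
      (H ⊆? X))
  ... | yes (X , a , b , c , d) = inj₂ (X , a , b , c , ⊈⇒∃ d)
  ... | no ¬w = inj₁ λ X a b c {u} → decidable-stable (H ⊆? X) (λ d → ¬w (X , a , b , c , d)) {u}

  opaque
    -- A closed subset of a closed set is closed, so descending through splits stays closed in `H`;
    -- where no split is left, a terminal strong component has been reached.
    terminal : ∀ {H} → Nonempty H → ∃ λ R → R ⊆ H × Nonempty R × Closed H R × Strong R
    terminal {H} ne = go H (⊂-wellFounded H) id ne (λ _ _ _ h _ → h)
      where
      go : ∀ R → Acc _⊂_ R → R ⊆ H → Nonempty R → Closed H R → ∃ λ R →
          R ⊆ H × Nonempty R × Closed H R × Strong R
      go R (acc rec) R⊆ ne c with strong-or-split R
      ... | inj₁ s = R , R⊆ , ne , c , s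
      ... | inj₂ (X , X⊆ , ne′ , c′ , v , v∈ , v∉) =
        go X (rec (X⊆ , v , v∈ , v∉)) (R⊆ ∘ X⊆) ne′
            (λ u w u∈ w∈ a → c′ u w u∈ (c u w (X⊆ u∈) w∈ a) a)

  -- The intersection of `X` with `H` is nonempty and closed in the strong `H`.
  absorb : ∀ {H K X x} → Strong H → H ⊆ K → Closed K X → x ∈ X → x ∈ H → H ⊆ X
  absorb {H} {K} {X} s H⊆K c x∈X x∈H u∈ =
    proj₁ (∈⟪⟫⁻ {P? = λ u → (u ∈? X) ×-dec (u ∈? H)} (s _ (proj₂ ∘ ∈⟪⟫⁻) (_ , ∈⟪⟫⁺ (x∈X , x∈H))
      (λ u w u∈ w∈ a → ∈⟪⟫⁺ (c u w (proj₁ (∈⟪⟫⁻ u∈)) (H⊆K w∈) a , w∈)) u∈))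

  Walk : Subset n → Fin n → Fin n → Set
  Walk G = Star (λ u w → w ∈ G × u ⟶ w)

  walk : ∀ {G u v} → Strong G → u ∈ G → v ∈ G → Walk G u v
  walk {G} {u} {v} s u∈ v∈ = go _ (⊃-wellFounded ⟪ _≟ u ⟫) (λ h → subst (_∈ G) (sym (∈⟪⟫⁻ h)) u∈)
      (u , ∈⟪⟫⁺ refl)
    (λ _ h → subst (Walk G u) (sym (∈⟪⟫⁻ h)) ε)
    where
    go : ∀ X → Acc (flip _⊂_) X → X ⊆ G → Nonempty X → (∀ w → w ∈ X → Walk G u w) → Walk G u v
    go X (acc rec) X⊆ ne reach with v ∈? X
    ... | yes h = reach v h
    ... | no ¬h with escape s X⊆ ne v∈ ¬h
    ...   | x , w , x∈ , w∈ , w∉ , a = go (X ⊕ w) (rec (∈⊕ˡ , w , ∈⊕ʳ , w∉)) (⊕⊆ X⊆ w∈) (x , ∈⊕ˡ x∈)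
            (λ y y∈ → [ reach y , (λ { refl → reach x x∈ ◅◅ (w∈ , a) ◅ ε }) ]′ (∈⊕⁻ y∈))

  -- Ears and the growth of a strong part

  From To : Subset n → Fin n → Set
  From H q = ∃ λ x → x ∈ H × x ⟶ q
  To   H q = ∃ λ x → x ∈ H × q ⟶ x

  from? : ∀ H q → Dec (From H q)
  from? H q = any? (λ x → (x ∈? H) ×-dec (x ⟶? q))

  to? : ∀ H q → Dec (To H q)
  to? H q = any? (λ x → (x ∈? H) ×-dec (q ⟶? x))

  -- H ≼[ a , b ] K says that the excess (number of nonadjacent pairs − order + 2)
  -- satisfies excess H + a ≤ excess K + b, doubled because gaps counts ordered pairs.
  infix 4 _≼[_,_]_
  record _≼[_,_]_ (H : Subset n) (a b : ℕ) (K : Subset n) : Set where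
    constructor grows
    field bound : gaps H + 2 * card K + 2 * a ≤ gaps K + 2 * card H + 2 * b

  ≼-refl : ∀ {H} → H ≼[ 0 , 0 ] H
  ≼-refl = grows ≤-refl

  ≼-trans : ∀ {H K L a b c d} → H ≼[ a , b ] K → K ≼[ c , d ] L → H ≼[ a + c , b + d ] L
  ≼-trans {H} {K} {L} {a} {b} {c} {d} (grows p) (grows q) =
      grows (arith (gaps H) (card H) (gaps K) (card K) (gaps L) (card L) a b c d p q)
    where
    arith : ∀ gh h gk k gl l a b c d → gh + 2 * k + 2 * a ≤ gk + 2 * h + 2 * b →
        gk + 2 * l + 2 * c ≤ gl + 2 * k + 2 * d →
            gh + 2 * l + 2 * (a + c) ≤ gl + 2 * h + 2 * (b + d)
    arith gh h gk k gl l a b c d p q = farkas 0 (p ⊞ q)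
      (solve (gh ∷ h ∷ gk ∷ k ∷ gl ∷ l ∷ a ∷ b ∷ c ∷ d ∷ []))

  ≼-weaken : ∀ {H K a b} c d → H ≼[ a , b ] K → c + b ≤ a + d → H ≼[ c , d ] K
  ≼-weaken {H} {K} {a} {b} c d (grows p) q = grows
      (arith (gaps H) (card H) (gaps K) (card K) a b p q)
    where
    arith : ∀ gh h gk k a b → gh + 2 * k + 2 * a ≤ gk + 2 * h + 2 * b → c + b ≤ a + d →
            gh + 2 * k + 2 * c ≤ gk + 2 * h + 2 * d
    arith gh h gk k a b p q = farkas 0 (p ⊞ q ⊞ q) (solve (gh ∷ h ∷ gk ∷ k ∷ a ∷ b ∷ c ∷ d ∷ []))

  -- In fact an equality: the nonadjacent pairs rise by `miss q H` and the order by 1. All later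
  -- costs are composed of such steps.
  ≼-⊕ : ∀ {H q} → q ∉ H → H ≼[ miss q H , 1 ] H ⊕ q
  ≼-⊕ {H} {q} q∉ = grows (≤-reflexive (trans (cong (λ c → gaps H + 2 * c + 2 * miss q H)
      (card-⊕ q∉))
    (trans (arith (gaps H) (card H) (miss q H))
        (cong (λ g → g + 2 * card H + 2) (sym (gaps-⊕ q∉))))))
    where
    arith : ∀ g h m → g + 2 * (h + 1) + 2 * m ≡ g + 2 * m + 2 * h + 2
    arith g h m = solve (g ∷ h ∷ m ∷ [])

  -- The ear is entered at `i` and returns to `H` from `o`. In `cost` the first alternative is an
  -- ear with just these two inner vertices, where each vertex of `H` misses one of them; the second
  -- is a longer ear, where a vertex strictly between misses all of `H`.
  record Ear (G H : Subset n) : Set where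
    field
      K      : Subset n
      i o    : Fin n
      strong : Strong K
      H⊆K    : H ⊆ K
      K⊆G    : K ⊆ G
      i∈K    : i ∈ K
      i∉H    : i ∉ H
      fromH  : From H i
      ¬fromO : ¬ From H o
      shape  : ∀ u → u ∈ K → u ∈ H ⊎ u ≡ i ⊎ u ≡ o ⊎ (¬ From H u × ¬ To H u)
      cost   : H ≼[ card H , 2 ] K ⊎ H ≼[ miss i H + card H , 3 ] K
      miss<  : miss i H + 1 ≤ card H

  module _ {G H : Subset n} (strongH : Strong H) (H⊆G : H ⊆ G)
    (noEar : ∀ q → q ∈ G → q ∉ H → From H q → ¬ To H q) where

    -- A walk leaving H at i and currently at t, passing since then only through
    -- vertices without arcs to or from H; K is H together with the part walked.
    record State (i : Fin n) (K : Subset n) (t : Fin n) : Set where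
      field
        i∉H    : i ∉ H
        fromH  : From H i
        H⊆K    : H ⊆ K
        K⊆G    : K ⊆ G
        i∈K    : i ∈ K
        t∈K    : t ∈ K
        t∉H    : t ∉ H
        ¬toH   : ¬ To H t
        shape  : ∀ u → u ∈ K → u ∈ H ⊎ u ≡ i ⊎ (¬ From H u × ¬ To H u)
        -- `reach` and `spread` are the two halves of strength; an arc from the last vertex back to
        -- `H` will join them.
        reach  : ∀ X → X ⊆ K → Nonempty X → Closed K X → t ∈ X
        spread : ∀ X → X ⊆ K → Closed K X → (∃ λ x → x ∈ X × x ∈ H) → K ⊆ X
        -- As long as the walk consists of `i` alone nothing is charged: the cost depends on whether
        -- the next vertex already returns to `H`.
        cost   : (t ≡ i × K ≡ H ⊕ i) ⊎ H ≼[ miss i H + card H , 2 ] K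

    start : ∀ {i} → i ∈ G → i ∉ H → From H i → State i (H ⊕ i) i
    start {i} i∈ i∉ (y , y∈ , a) = record
      { i∉H = i∉ ; fromH = y , y∈ , a ; H⊆K = ∈⊕ˡ ; K⊆G = ⊕⊆ H⊆G i∈ ; i∈K = ∈⊕ʳ ; t∈K = ∈⊕ʳ
      ; t∉H = i∉
      ; ¬toH = noEar i i∈ i∉ (y , y∈ , a)
      ; shape = λ u u∈ → [ inj₁ , inj₂ ∘ inj₁ ]′ (∈⊕⁻ u∈)
      ; reach = λ { X X⊆ (x , x∈) c → [ (λ x∈H → toI X c x∈ x∈H) ,
          (λ { refl → x∈ }) ]′ (∈⊕⁻ (X⊆ x∈)) }
      ; spread = λ { X X⊆ c (x , x∈ , x∈H) → ⊕⊆ (absorb strongH ∈⊕ˡ c x∈ x∈H) (toI X c x∈ x∈H) }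
      ; cost = inj₁ (refl , refl) }
      where
      toI : ∀ X → Closed (H ⊕ i) X → ∀ {x} → x ∈ X → x ∈ H → i ∈ X
      toI X c x∈ x∈H = c y i (absorb strongH ∈⊕ˡ c x∈ x∈H y∈) ∈⊕ʳ a

    closed-⊕ : ∀ {K X q} → Closed (K ⊕ q) X → Closed K ⟪ (λ u → (u ∈? X) ×-dec (u ∈? K)) ⟫
    closed-⊕ c u w u∈ w∈ a = ∈⟪⟫⁺ (c u w (proj₁ (∈⟪⟫⁻ u∈)) (∈⊕ˡ w∈) a , w∈)

    module _ {i K t} (s : State i K t) where
      open State s

      reach-⊕ : ∀ {q} → t ⟶ q → ∀ X → X ⊆ K ⊕ q → Nonempty X → Closed (K ⊕ q) X → q ∈ X
      reach-⊕ {q} a X X⊆ (x , x∈) c with ∈⊕⁻ (X⊆ x∈)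
      ... | inj₂ refl = x∈
      ... | inj₁ x∈K  = c t q (proj₁ (∈⟪⟫⁻ (reach _ (proj₂ ∘ ∈⟪⟫⁻) (x , ∈⟪⟫⁺ (x∈ , x∈K))
          (closed-⊕ c)))) ∈⊕ʳ a

      spread-⊕ : ∀ {q} → t ⟶ q → ∀ X → X ⊆ K ⊕ q → Closed (K ⊕ q) X → (∃ λ x → x ∈ X × x ∈ H) →
          K ⊕ q ⊆ X
      spread-⊕ {q} a X X⊆ c (x , x∈ , x∈H) = ⊕⊆ K⊆X (c t q (K⊆X t∈K) ∈⊕ʳ a)
        where
        K⊆X : K ⊆ X
        K⊆X u∈ = proj₁ (∈⟪⟫⁻ {P? = λ u → (u ∈? X) ×-dec (u ∈? K)}
          (spread _ (proj₂ ∘ ∈⟪⟫⁻) (closed-⊕ c) (x , ∈⟪⟫⁺ (x∈ , H⊆K x∈H) , x∈H) u∈))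

      advance : ∀ {q} → q ∈ G → q ∉ H → ¬ From H q → ¬ To H q → t ⟶ q → ∃ λ K′ → State i K′ q
      advance {q} q∈ q∉H ¬f ¬t a with q ∈? K
      ... | yes q∈K = K , record
        { i∉H = i∉H ; fromH = fromH ; H⊆K = H⊆K ; K⊆G = K⊆G ; i∈K = i∈K ; t∈K = q∈K ; t∉H = q∉H
        ; ¬toH = ¬t ; shape = shape
        ; reach = λ X X⊆ ne c → c t q (reach X X⊆ ne c) q∈K a
        ; spread = spread
        -- With only `i` walked so far, `q` would be `i` itself and the arc a loop.
        ; cost = [ (λ { (refl , refl) → ⊥-elim ([ q∉H , (λ { refl → loopless _ a }) ]′ (∈⊕⁻ q∈K)) })
            , inj₂ ]′ cost }
      ... | no q∉K = K ⊕ q , record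
        { i∉H = i∉H ; fromH = fromH ; H⊆K = ∈⊕ˡ ∘ H⊆K ; K⊆G = ⊕⊆ K⊆G q∈ ; i∈K = ∈⊕ˡ i∈K ; t∈K = ∈⊕ʳ
        ; t∉H = q∉H ; ¬toH = ¬t
        ; shape = λ u u∈ → [ shape u , (λ { refl → inj₂ (inj₂ (¬f , ¬t)) }) ]′ (∈⊕⁻ u∈)
        ; reach = reach-⊕ a
        ; spread = spread-⊕ a
        ; cost = inj₂ (cost′ cost) }
        where
        apartH : card H ≤ miss q K
        apartH = #-mono (λ u u∈ → H⊆K u∈ , ∈∉⇒≢ u∈ q∉H ∘ sym , (λ b → ¬t (u , u∈ , b)) ,
            (λ b → ¬f (u , u∈ , b)))
        cost′ : (t ≡ i × K ≡ H ⊕ i) ⊎ H ≼[ miss i H + card H , 2 ] K → H ≼[ miss i H + card H ,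
            2 ] K ⊕ q
        cost′ (inj₁ (_ , refl)) = ≼-weaken _ 2 (≼-trans (≼-⊕ i∉H) (≼-⊕ q∉K))
            (+-monoˡ-≤ 2 (+-monoʳ-≤ (miss i H) apartH))
        -- A further inner vertex misses the nonempty `H`, so it pays for its own contribution to
        -- the order.
        cost′ (inj₂ p) = ≼-weaken _ 2 (≼-trans p (≼-⊕ q∉K)) (arith (miss i H + card H) (miss q K)
            (≤-trans (∃⇒# (proj₁ (proj₂ fromH))) apartH))
          where
          arith : ∀ a m → 1 ≤ m → a + 3 ≤ a + m + 2
          arith a m h = farkas 0 h (solve (a ∷ m ∷ []))

      finish : ∀ {o} → o ∈ G → o ∉ H → ¬ From H o → To H o → t ⟶ o → Ear G H
      finish {o} o∈ o∉H ¬f (y , y∈ , b) a = record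
        { K = K ⊕ o ; i = i ; o = o
        ; strong = λ X X⊆ ne c → spread-⊕ a X X⊆ c
            (y , c o y (reach-⊕ a X X⊆ ne c) (∈⊕ˡ (H⊆K y∈)) b , y∈)
        ; H⊆K = ∈⊕ˡ ∘ H⊆K ; K⊆G = ⊕⊆ K⊆G o∈ ; i∈K = ∈⊕ˡ i∈K ; i∉H = i∉H ; fromH = fromH
        ; ¬fromO = ¬f
        ; shape = λ u u∈ → [ (λ u∈K → [ inj₁ , [ inj₂ ∘ inj₁ , inj₂ ∘ inj₂ ∘ inj₂ ]′ ]′
            (shape u u∈K)) , inj₂ ∘ inj₂ ∘ inj₁ ]′ (∈⊕⁻ u∈)
        ; cost = cost′ cost
        ; miss< = ≤-trans (+-monoʳ-≤ (miss i H) (∃⇒# {P? = λ u → (u ∈? H) ×-dec (u ⟶? i)}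
            (proj₂ fromH)))
            (#-disjoint (λ _ → proj₁) (λ _ → proj₁) (λ { _ (_ , _ , _ , ¬a) (_ , a) → ¬a a })) }
        where
        o∉K : o ∉ K
        o∉K h with shape o h
        ... | inj₁ x = o∉H x
        ... | inj₂ (inj₁ refl) = ¬f fromH
        ... | inj₂ (inj₂ (_ , ¬t)) = ¬t (y , y∈ , b)
        cost′ : (t ≡ i × K ≡ H ⊕ i) ⊎ H ≼[ miss i H + card H , 2 ] K → H ≼[ card H ,
            2 ] K ⊕ o ⊎ H ≼[ miss i H + card H , 3 ] K ⊕ o
        cost′ (inj₁ (refl , refl)) = inj₁ (≼-weaken _ 2 (≼-trans (≼-⊕ i∉H) (≼-⊕ o∉K))
            (+-monoˡ-≤ 2 (≤-trans (#-cover cover) (+-monoʳ-≤ (miss i H) (miss-mono o H⊆K)))))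
          where
          -- An x ∈ H adjacent to both ends of the ear would close the triangle x i o.
          cover : ∀ x → x ∈ H → (x ∈ H × Apart i x) ⊎ (x ∈ H × Apart o x)
          cover x x∈ with adjacency (∈∉⇒≢ x∈ i∉H ∘ sym)
          ... | none p = inj₁ (x∈ , p)
          ... | out p  = ⊥-elim (¬toH (x , x∈ , p))
          ... | inn p with adjacency (∈∉⇒≢ x∈ o∉H ∘ sym)
          ...   | none q = inj₂ (x∈ , q)
          ...   | out q  = ⊥-elim (no3 p a q)
          ...   | inn q  = ⊥-elim (¬f (x , x∈ , q))
        cost′ (inj₂ p) = inj₂ (≼-weaken _ 3 (≼-trans p (≼-⊕ o∉K))
            (arith (miss i H + card H) (miss o K)))
          where
          arith : ∀ a m → a + 3 ≤ a + m + 3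
          arith a m = +-monoˡ-≤ 3 (m≤m+n a m)

    -- Restarting at every vertex with an arc from `H` ensures that the part kept has such an arc at
    -- its first vertex only. By `noEar` that vertex has no arc back, so the ear has at least two
    -- inner vertices.
    follow : ∀ {i K t x} → State i K t → x ∈ H → Walk G t x → Ear G H
    follow s x∈ ε = ⊥-elim (State.t∉H s x∈)
    follow s x∈ (_◅_ {j = u} (u∈ , a) w) with u ∈? H
    ... | yes u∈H = ⊥-elim (State.¬toH s (u , u∈H , a))
    ... | no u∉H with from? H u | to? H u
    ...   | yes f | _      = follow (start u∈ u∉H f) x∈ w
    ...   | no ¬f | yes t  = finish s u∈ u∉H ¬f t a
    ...   | no ¬f | no ¬t  = follow (proj₂ (advance s u∈ u∉H ¬f ¬t a)) x∈ w

    opaque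
      ear : ∀ {v} → Strong G → v ∈ G → v ∉ H → From H v → Ear G H
      ear {v} sG v∈ v∉ (x , x∈ , a) = follow (start v∈ v∉ (x , x∈ , a)) x∈ (walk sG v∈ (H⊆G x∈))

  -- The out-neighbours of `q` in `H` form a nonempty proper subset. An arc u → w leaving it ends at
  -- a nonneighbour of `q`, since w → q would close a triangle.
  miss≥1 : ∀ {H q} → Strong H → q ∉ H → From H q → To H q → 1 ≤ miss q H
  miss≥1 {H} {q} s q∉ (x , x∈ , a) (y , y∈ , b)
    with escape {X = ⟪ (λ u → (u ∈? H) ×-dec (q ⟶? u)) ⟫} s (proj₁ ∘ ∈⟪⟫⁻) (y , ∈⟪⟫⁺ (y∈ , b)) x∈
        (λ h → no2 a (proj₂ (∈⟪⟫⁻ h)))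
  ... | u , w , u∈ , w∈ , w∉ , c = ∃⇒# (w∈ , ∈∉⇒≢ w∈ q∉ ∘ sym , (λ e → w∉ (∈⟪⟫⁺ (w∈ , e))) ,
      no3 (proj₂ (∈⟪⟫⁻ u∈)) c)

  record Growth (G H : Subset n) (v : Fin n) : Set where
    field
      K      : Subset n
      strong : Strong K
      H⊂K    : H ⊂ K
      K⊆G    : K ⊆ G
      mono   : H ≼[ 0 , 0 ] K
      attach : v ∉ K ⊎ H ≼[ miss v H , 1 ] K

  opaque
    -- A single vertex with arcs from and to `H` is added if there is one; otherwise a longer ear
    -- is. Since `v` has an arc from `H`, it can occur on that ear only as its first vertex `i`,
    -- whose nonneighbours are covered by the cost of the ear.
    grow : ∀ {G H v} → Strong G → Strong H → H ⊆ G → 3 ≤ card H → v ∈ G → v ∉ H → From H v →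
        Growth G H v
    grow {G} {H} {v} sG sH H⊆G h≥3 v∈ v∉ f
      with any? (λ q → (q ∈? G) ×-dec ¬? (q ∈? H) ×-dec from? H q ×-dec to? H q)
    ... | yes (q , q∈ , q∉ , f′@(x , x∈ , a) , t′@(y , y∈ , b)) = record
      { K = H ⊕ q ; H⊂K = ∈⊕ˡ , q , ∈⊕ʳ , q∉ ; K⊆G = ⊕⊆ H⊆G q∈
      ; strong = λ { X X⊆ (u , u∈) c →
          let H⊆X : H ⊆ X
              H⊆X = [ absorb sH ∈⊕ˡ c u∈ , (λ { refl → absorb sH ∈⊕ˡ c (c q y u∈ (∈⊕ˡ y∈) b) y∈ })
                  ]′ (∈⊕⁻ (X⊆ u∈))
          in ⊕⊆ H⊆X (c x q (H⊆X x∈) ∈⊕ʳ a) }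
      ; mono = ≼-weaken 0 0 (≼-⊕ q∉) (≤-trans (miss≥1 sH q∉ f′ t′) (m≤m+n _ 0))
      ; attach = attach (v ≟ q) }
      where
      attach : Dec (v ≡ q) → v ∉ H ⊕ q ⊎ H ≼[ miss v H , 1 ] H ⊕ q
      attach (yes refl) = inj₂ (≼-⊕ q∉)
      attach (no v≢q)   = inj₁ ([ v∉ , v≢q ]′ ∘ ∈⊕⁻)
    ... | no ¬q = record
      { K = K ; strong = strong ; H⊂K = H⊆K , i , i∈K , i∉H ; K⊆G = K⊆G
      ; mono = mono cost
      ; attach = attach (v ∈? K) }
      where
      noEar : ∀ q → q ∈ G → q ∉ H → From H q → ¬ To H q
      noEar q a b c d = ¬q (q , a , b , c , d)
      open Ear (ear sH H⊆G noEar sG v∈ v∉ f)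
      mono : H ≼[ card H , 2 ] K ⊎ H ≼[ miss i H + card H , 3 ] K → H ≼[ 0 , 0 ] K
      mono (inj₁ p) = ≼-weaken 0 0 p (≤-trans (≤-trans (n≤1+n 2) h≥3) (m≤m+n _ 0))
      mono (inj₂ p) = ≼-weaken 0 0 p (≤-trans h≥3 (≤-trans (m≤n+m _ (miss i H)) (m≤m+n _ 0)))
      gain : H ≼[ card H , 2 ] K ⊎ H ≼[ miss i H + card H , 3 ] K → H ≼[ miss i H , 1 ] K
      gain (inj₁ p) = ≼-weaken _ 1 p (arith (miss i H) (card H) miss<)
        where
        arith : ∀ m h → m + 1 ≤ h → m + 2 ≤ h + 1
        arith m h p = farkas 0 p (solve (m ∷ h ∷ []))
      gain (inj₂ p) = ≼-weaken _ 1 p (arith (miss i H) (card H) h≥3)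
        where
        arith : ∀ m h → 3 ≤ h → m + 3 ≤ m + h + 1
        arith m h p = farkas 1 p (solve (m ∷ h ∷ []))
      attach : Dec (v ∈ K) → v ∉ K ⊎ H ≼[ miss v H , 1 ] K
      attach (no v∉K) = inj₁ v∉K
      attach (yes v∈K) with shape v v∈K
      ... | inj₁ x = ⊥-elim (v∉ x)
      ... | inj₂ (inj₁ e) = inj₂ (subst (λ z → H ≼[ miss z H , 1 ] K) (sym e) (gain cost))
      ... | inj₂ (inj₂ (inj₂ (¬f , _))) = ⊥-elim (¬f f)
      ... | inj₂ (inj₂ (inj₁ e)) = ⊥-elim (¬fromO (subst (From H) e f))

  ≼-strong : ∀ {G H} → Strong G → Strong H → H ⊆ G → 3 ≤ card H → H ≼[ 0 , 0 ] G
  ≼-strong {G} {H} sG sH H⊆G h≥3 = go H (⊃-wellFounded H) sH H⊆G h≥3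
    where
    go : ∀ H → Acc (flip _⊂_) H → Strong H → H ⊆ G → 3 ≤ card H → H ≼[ 0 , 0 ] G
    go H (acc rec) sH H⊆G h≥3 with G ⊆? H
    ... | yes G⊆H = subst (H ≼[ 0 , 0 ]_) (⊆-antisym H⊆G G⊆H) ≼-refl
    ... | no G⊈H with ⊈⇒∃ G⊈H | #⇒∃ (≤-trans (s≤s z≤n) h≥3)
    ...   | v , v∈ , v∉ | ne with escape sG H⊆G ne v∈ v∉
    ...     | x , w , x∈ , w∈ , w∉ , a =
      ≼-trans mono (go K (rec H⊂K) strong K⊆G (≤-trans h≥3 (card-mono (proj₁ H⊂K))))
      where open Growth (grow sG sH H⊆G h≥3 w∈ w∉ (x , x∈ , a))

  -- While `v` stays outside, the part grows without loss and the number of vertices missed by `v`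
  -- can only rise, so the late addition of `v` costs at least as much as an immediate one.
  ≼-attach : ∀ {G H v} → Strong G → Strong H → H ⊆ G → 3 ≤ card H → v ∈ G → v ∉ H → From H v →
      H ≼[ miss v H , 1 ] G
  ≼-attach {G} {H} {v} sG sH H⊆G h≥3 v∈ v∉ f = go H (⊃-wellFounded H) sH H⊆G h≥3 v∉ f
    where
    go : ∀ H → Acc (flip _⊂_) H → Strong H → H ⊆ G → 3 ≤ card H → v ∉ H → From H v → H ≼[ miss v H ,
        1 ] G
    go H (acc rec) sH H⊆G h≥3 v∉ f = step attach
      where
      open Growth (grow sG sH H⊆G h≥3 v∈ v∉ f)
      k≥3 : 3 ≤ card K
      k≥3 = ≤-trans h≥3 (card-mono (proj₁ H⊂K))
      step : v ∉ K ⊎ H ≼[ miss v H , 1 ] K → H ≼[ miss v H , 1 ] G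
      step (inj₁ v∉K) = ≼-weaken _ 1 (≼-trans mono (go K (rec H⊂K) strong K⊆G k≥3 v∉K
        (proj₁ f , proj₁ H⊂K (proj₁ (proj₂ f)) , proj₂ (proj₂ f))))
            (+-monoˡ-≤ 1 (miss-mono v (proj₁ H⊂K)))
      step (inj₂ p) = ≼-weaken _ 1 (≼-trans p (≼-strong sG strong K⊆G k≥3))
          (≤-reflexive (arith (miss v H)))
        where
        arith : ∀ m → m + 1 ≡ m + 0 + 1
        arith m = solve (m ∷ [])

  -- Nonnegativity of the excess

  Nontrivial : Subset n → Set
  Nontrivial H = ∃ λ u → ∃ λ v → u ∈ H × v ∈ H × u ≢ v

  another : ∀ {G} → Nontrivial G → ∀ v → ∃ λ w → w ∈ G × v ≢ w
  another (a , b , a∈ , b∈ , a≢b) v with v ≟ a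
  ... | yes refl = b , b∈ , a≢b
  ... | no v≢a   = a , a∈ , v≢a

  successor : ∀ {G u v} → Strong G → u ∈ G → v ∈ G → u ≢ v → ∃ λ w → w ∈ G × u ⟶ w
  successor {G} {u} {v} s u∈ v∈ u≢v
    with escape {X = ⟪ _≟ u ⟫} s (λ h → subst (_∈ G) (sym (∈⟪⟫⁻ h)) u∈) (u , ∈⟪⟫⁺ refl) v∈
        (λ h → u≢v (sym (∈⟪⟫⁻ h)))
  ... | x , w , x∈ , w∈ , _ , a = w , w∈ , subst (_⟶ w) (∈⟪⟫⁻ x∈) a

  -- Three consecutive arcs cannot repeat a vertex without closing a cycle of length 2 or 3.
  four≤card : ∀ {G} → Strong G → Nontrivial G → 4 ≤ card G
  four≤card {G} s (u , v , u∈ , v∈ , u≢v) with successor s u∈ v∈ u≢v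
  ... | a , a∈ , ua with successor s a∈ u∈ (⟶⇒≢ ua ∘ sym)
  ...   | b , b∈ , ab with successor s b∈ a∈ (⟶⇒≢ ab ∘ sym)
  ...     | c , c∈ , bc = ≤-trans (≤-reflexive (sym four)) (card-mono (⊕⊆ (⊕⊆ (⊕⊆ U⊆ a∈) b∈) c∈))
    where
    U : Subset n
    U = ⟪ _≟ u ⟫
    U⊆ : U ⊆ G
    U⊆ h = subst (_∈ G) (sym (∈⟪⟫⁻ h)) u∈
    one : card U ≡ 1
    one = ≤-antisym (≤-trans (#-mono (λ _ → ∈⟪⟫⁻)) (≤-reflexive (#-≡ u))) (∃⇒# (∈⟪⟫⁺ refl))
    a∉ : a ∉ U
    a∉ h = ⟶⇒≢ ua (sym (∈⟪⟫⁻ h))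
    b∉ : b ∉ U ⊕ a
    b∉ = [ (λ h → no2 ab (subst (_⟶ a) (sym (∈⟪⟫⁻ h)) ua)) , ⟶⇒≢ ab ∘ sym ]′ ∘ ∈⊕⁻
    c∉ : c ∉ U ⊕ a ⊕ b
    c∉ = [ [ (λ h → no3 ua ab (subst (b ⟶_) (∈⟪⟫⁻ h) bc)) ,
        (λ e → no2 ab (subst (b ⟶_) e bc)) ]′ ∘ ∈⊕⁻ , ⟶⇒≢ bc ∘ sym ]′ ∘ ∈⊕⁻
    four : card (U ⊕ a ⊕ b ⊕ c) ≡ 4
    four = trans (card-⊕ c∉) (cong (_+ 1) (trans (card-⊕ b∉)
        (cong (_+ 1) (trans (card-⊕ a∉) (cong (_+ 1) one)))))

  strong? : ∀ H → Dec (Strong H)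
  strong? H with strong-or-split H
  ... | inj₁ s = yes s
  ... | inj₂ (X , X⊆ , ne , c , v , v∈ , v∉) = no (λ s → v∉ (s X X⊆ ne c v∈))

  nontrivial? : ∀ H → Dec (Nontrivial H)
  nontrivial? H = any? λ u → any? λ v → (u ∈? H) ×-dec (v ∈? H) ×-dec ¬? (u ≟ v)

  singleton-strong : ∀ v → Strong ⟪ _≟ v ⟫
  singleton-strong v X X⊆ (x , x∈) _ u∈ = subst (_∈ X) (trans (∈⟪⟫⁻ (X⊆ x∈)) (sym (∈⟪⟫⁻ u∈))) x∈

  -- A strong G without smaller nontrivial strong parts is exhausted by an ear from
  -- any of its vertices v, so v has at least |G| − 3 nonneighbours.
  excess≥0 : ∀ {G} → Strong G → Nontrivial G → 2 * card G ≤ gaps G + 4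
  excess≥0 {G} s nt = go G (⊂-wellFounded G) s nt
    where
    go : ∀ G → Acc _⊂_ G → Strong G → Nontrivial G → 2 * card G ≤ gaps G + 4
    go G (acc rec) s nt with anySubset? (λ M → (M ⊆? G) ×-dec ¬? (G ⊆? M) ×-dec strong? M ×-dec
        nontrivial? M)
    ... | yes (M , M⊆ , G⊈ , sM , ntM) =
      arith (gaps M) (card M) (gaps G) (card G) (go M (rec (M⊆ , ⊈⇒∃ G⊈)) sM ntM)
        (_≼[_,_]_.bound (≼-strong s sM M⊆ (≤-trans (n≤1+n 3) (four≤card sM ntM))))
      where
      arith : ∀ x c y g → 2 * c ≤ x + 4 → x + 2 * g + 2 * 0 ≤ y + 2 * c + 2 * 0 → 2 * g ≤ y + 4
      arith x c y g p q = farkas 0 (p ⊞ q) (solve (x ∷ c ∷ y ∷ g ∷ []))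
    ... | no minimal = arith (card G) (four≤card s nt)
        (≤-trans (≤-reflexive (sym (∑∈-const G (card G))))
            (≤-trans (∑∈-mono G manyGaps) (≤-reflexive
              (trans (∑∈-+ G _ _) (cong (gaps G +_) (∑∈-const G 3))))))
      where
      manyGaps : ∀ v → v ∈ G → card G ≤ miss v G + 3
      manyGaps v v∈ = ≤-trans (#-cover {Q? = λ u → (u ∈? G) ×-dec apart? v u}
          {R? = λ u → (u ≟ v) ⊎-dec (u ≟ i) ⊎-dec (u ≟ o)} cover)
          (+-monoʳ-≤ (miss v G) (≤-trans (#-cover {Q? = _≟ v} {R? = λ u → (u ≟ i) ⊎-dec (u ≟ o)}
            (λ _ → id)) (≤-trans (+-monoʳ-≤ _ (#-cover {Q? = _≟ i} {R? = _≟ o} (λ _ → id)))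
            (≤-reflexive (cong₂ _+_ (#-≡ v) (cong₂ _+_ (#-≡ i) (#-≡ o)))))))
        where
        V : Subset n
        V = ⟪ _≟ v ⟫
        V⊆ : V ⊆ G
        V⊆ h = subst (_∈ G) (sym (∈⟪⟫⁻ h)) v∈
        other : ∃ λ w → w ∈ G × v ≢ w
        other = another nt v
        onward : ∃ λ w → w ∈ G × v ⟶ w
        onward = successor s v∈ (proj₁ (proj₂ other)) (proj₂ (proj₂ other))
        noEar : ∀ q → q ∈ G → q ∉ V → From V q → ¬ To V q
        noEar q _ _ (x , x∈ , a) (y , y∈ , b) =
            no2 a (subst (q ⟶_) (trans (∈⟪⟫⁻ y∈) (sym (∈⟪⟫⁻ x∈))) b)
        e : Ear G V
        e = ear (singleton-strong v) V⊆ noEar s (proj₁ (proj₂ onward))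
          (λ h → ⟶⇒≢ (proj₂ (proj₂ onward)) (sym (∈⟪⟫⁻ h))) (v , ∈⟪⟫⁺ refl , proj₂ (proj₂ onward))
        open Ear e
        G⊆K : G ⊆ K
        G⊆K = decidable-stable (G ⊆? K) (λ h → minimal (K , K⊆G , h , strong ,
          v , i , H⊆K (∈⟪⟫⁺ refl) , i∈K , (λ v≡i → i∉H (∈⟪⟫⁺ (sym v≡i)))))
        cover : ∀ u → u ∈ G → (u ∈ G × Apart v u) ⊎ (u ≡ v ⊎ u ≡ i ⊎ u ≡ o)
        cover u u∈ with shape u (G⊆K u∈)
        ... | inj₁ h = inj₂ (inj₁ (∈⟪⟫⁻ h))
        ... | inj₂ (inj₁ p) = inj₂ (inj₂ (inj₁ p))
        ... | inj₂ (inj₂ (inj₁ p)) = inj₂ (inj₂ (inj₂ p))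
        ... | inj₂ (inj₂ (inj₂ (¬f , ¬t))) with u ≟ v
        ...   | yes p = inj₂ (inj₁ p)
        ...   | no u≢v = inj₁ (u∈ , u≢v ∘ sym , (λ a → ¬f (v , ∈⟪⟫⁺ refl , a)) ,
            (λ a → ¬t (v , ∈⟪⟫⁺ refl , a)))
      arith : ∀ g {x} → 4 ≤ g → g * g ≤ x + g * 3 → 2 * g ≤ x + 4
      arith g {x} h p = shifted (g ∸ 4) x (sym (m+[n∸m]≡n h)) p
        where
        shifted : ∀ k x {g} → g ≡ 4 + k → g * g ≤ x + g * 3 → 2 * g ≤ x + 4
        -- The inequality needed is (g - 1)(g - 4) ≥ 0; with g = 4 + k the product is the slack.
        shifted k x refl p = farkas (k * (3 + k)) p (solve (k ∷ x ∷ []))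

  -- Strong parts with a single exit

  outd-⊕ : ∀ {H q} u → q ∉ H → outd u (H ⊕ q) ≡ outd u H + [ u ⟶? q ]
  outd-⊕ {H} {q} u q∉ = trans (sym (∑∈-# (H ⊕ q) (u ⟶?_)))
    (trans (∑∈-⊕ H (λ v → [ u ⟶? v ]) q∉) (cong (_+ [ u ⟶? q ]) (∑∈-# H (u ⟶?_))))

  atMostOne : ∀ {P : Fin n → Set} {P? : Decidable P} {u v} → # P? ≤ 1 → P u → P v → u ≡ v
  atMostOne {P} {P?} {u} {v} h pu pv with u ≟ v
  ... | yes e = e
  ... | no u≢v = ⊥-elim (absurd-≤ 0 (≤-trans (≤-reflexive (sym (cong₂ _+_ (#-≡ u) (#-≡ v))))
          (≤-trans (#-disjoint {P? = _≟ u} {Q? = _≟ v} (λ { _ refl → pu }) (λ { _ refl → pv })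
            (λ { _ e e′ → u≢v (trans (sym e) e′) })) h)) refl)

  arcs-out : ∀ R w (f : Fin n → ℕ) → (∀ u → u ∈ R → 2 ≤ outd u R + [ u ⟶? w ] + f u) →
      2 * card R ≤ arcsIn R + ind w R + ∑∈ R f
  arcs-out R w f h = ≤-trans (≤-reflexive (trans (*-comm 2 (card R)) (sym (∑∈-const R 2))))
      (≤-trans (∑∈-mono R h)
    (≤-reflexive (trans (∑∈-+ R _ f) (cong (_+ ∑∈ R f)
        (trans (∑∈-+ R _ _) (cong (arcsIn R +_) (∑∈-# R (_⟶? w))))))))

  ∑∈-≟ : ∀ (R : Subset n) z → ∑∈ R (λ u → [ u ≟ z ]) ≤ 1
  ∑∈-≟ R z = ≤-trans (≤-reflexive (∑∈-# R (_≟ z)))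
      (≤-trans (#-mono (λ _ → proj₂)) (≤-reflexive (#-≡ z)))

  -- Nonnegative excess leaves at least 2 of the 6 pairs nonadjacent.
  fourVertices : ∀ {R} → Strong R → Nontrivial R → card R ≡ 4 → arcsIn R ≤ 4
  fourVertices {R} s nt r≡4 = *-cancelˡ-≤ 2 (arith (arcsIn R) (gaps R)
      (≤-reflexive (subst (λ r → 2 * arcsIn R + gaps R + r ≡ r * r) r≡4 (arcs-gaps R)))
    (subst (λ r → 2 * r ≤ gaps R + 4) r≡4 (excess≥0 s nt)))
    where
    arith : ∀ a g → 2 * a + g + 4 ≤ 16 → 8 ≤ g + 4 → 2 * a ≤ 8
    arith a g p q = farkas 0 (p ⊞ q) (solve (a ∷ g ∷ []))

  -- `R` arises as a terminal strong component, either of `G` without `w` or of the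
  -- out-neighbourhood of a vertex whose only nonneighbour is `w`.
  record Cut (G : Subset n) (w : Fin n) (R : Subset n) : Set where
    field
      R⊆G    : R ⊆ G
      w∈G    : w ∈ G
      w∉R    : w ∉ R
      strong : Strong R
      inh    : Nonempty R
      exits  : ∀ u v → u ∈ R → v ∈ G → u ⟶ v → v ∈ R ⊎ v ≡ w

  module _ {G w R} (strongG : Strong G) (cut : Cut G w R) where
    open Cut cut

    exit : From R w
    exit with escape strongG R⊆G inh w∈G w∉R
    ... | u , v , u∈ , v∈ , v∉ , a = u , u∈ ,
        subst (u ⟶_) ([ (λ h → ⊥-elim (v∉ h)) , id ]′ (exits u v u∈ v∈ a)) a

    out-⊕ : ∀ {u} → u ∈ R → outd u G ≤ outd u (R ⊕ w)
    out-⊕ {u} u∈ = #-mono (λ v → λ { (v∈ , a) → [ ∈⊕ˡ , (λ e → subst (_∈ R ⊕ w) (sym e) ∈⊕ʳ) ]′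
        (exits u v u∈ v∈ a) , a })

    out-R : ∀ {u} → u ∈ R → outd u G ≤ outd u R + [ u ⟶? w ]
    out-R {u} u∈ = ≤-trans (out-⊕ u∈) (≤-reflexive (outd-⊕ u w∉R))

    out-R≥1 : ∀ {u} → u ∈ R → 2 ≤ outd u G → 1 ≤ outd u R
    out-R≥1 {u} u∈ h = arith (outd u R) ([]≤1 (u ⟶? w)) (≤-trans h (out-R u∈))
      where
      arith : ∀ a {b} → b ≤ 1 → 2 ≤ a + b → 1 ≤ a
      arith a {b} p q = farkas 0 (p ⊞ q) (solve (a ∷ b ∷ []))

    nontrivial : ∀ {u} → u ∈ R → 1 ≤ outd u R → Nontrivial R
    nontrivial {u} u∈ h with #⇒∃ h
    ... | v , v∈ , a = u , v , u∈ , v∈ , ⟶⇒≢ a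

    closed-exit : ∀ {K X u} → R ⊆ K → w ∈ K → Closed K X → u ∈ X → u ∈ R → R ⊆ X × w ∈ X
    closed-exit R⊆K w∈K c u∈X u∈R = R⊆X , c (proj₁ exit) w (R⊆X (proj₁ (proj₂ exit))) w∈K
        (proj₂ (proj₂ exit))
      where R⊆X = absorb strong R⊆K c u∈X u∈R

    ⊕-strong : To R w → Strong (R ⊕ w)
    ⊕-strong (y , y∈ , a) X X⊆ (x , x∈) c = λ u∈ → [ proj₁ all ,
        (λ e → subst (_∈ X) (sym e) (proj₂ all)) ]′ (∈⊕⁻ u∈)
      where
      all : R ⊆ X × w ∈ X
      all with ∈⊕⁻ (X⊆ x∈)
      ... | inj₁ x∈R  = closed-exit ∈⊕ˡ ∈⊕ʳ c x∈ x∈R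
      ... | inj₂ refl = closed-exit ∈⊕ˡ ∈⊕ʳ c (c w y x∈ (∈⊕ˡ y∈) a) y∈

    -- If u → w with u in `R`, then t → u would close the triangle u w t, and u → t would leave `R`
    -- other than through `w`.
    miss-exit : ∀ {t} → t ∈ G → t ∉ R → w ⟶ t → ind w R ≤ miss t (R ⊕ w)
    miss-exit {t} t∈ t∉ a = #-mono (λ { u (u∈ , b) → ∈⊕ˡ u∈ , ∈∉⇒≢ u∈ t∉ ∘ sym , no3 b a ,
      (λ c → [ t∉ , ⟶⇒≢ a ∘ sym ]′ (exits u t u∈ t∈ c)) })

    cut-attach : ∀ {t} → To R w → Nontrivial R → t ∈ G → t ∉ R → w ⟶ t → R ⊕ w ≼[ ind w R , 1 ] G
    cut-attach {t} to nt t∈ t∉ a = ≼-weaken _ 1 (≼-attach strongG (⊕-strong to) (⊕⊆ R⊆G w∈G)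
        (≤-trans (≤-trans (n≤1+n 3) (four≤card strong nt)) (card-mono ∈⊕ˡ)) t∈
            ([ t∉ , ⟶⇒≢ a ∘ sym ]′ ∘ ∈⊕⁻) (w , ∈⊕ʳ , a))
        (+-monoˡ-≤ 1 (miss-exit t∈ t∉ a))

    miss+ind : ¬ To R w → card R ≤ miss w R + ind w R
    miss+ind ¬to = #-cover cover
      where
      cover : ∀ u → u ∈ R → (u ∈ R × Apart w u) ⊎ (u ∈ R × u ⟶ w)
      cover u u∈ with adjacency (∈∉⇒≢ u∈ w∉R)
      ... | out a  = inj₂ (u∈ , a)
      ... | inn a  = ⊥-elim (¬to (u , u∈ , a))
      ... | none a = inj₁ (u∈ , Apart-sym a)

  -- What a vertex x with a single nonneighbour w forces: every path from the
  -- out-neighbours of x to its in-neighbours passes through w.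
  record Bottleneck (G : Subset n) (x : Fin n) : Set where
    field
      w t  : Fin n
      R    : Subset n
      cut  : Cut G w R
      x≁w  : Apart x w
      x→R  : ∀ u → u ∈ R → x ⟶ u
      t∈G  : t ∈ G
      w→t  : w ⟶ t
      t→x  : t ⟶ x

    t∉R : t ∉ R
    t∉R h = no2 (x→R t h) t→x

    x∉R : x ∉ R
    x∉R h = loopless x (x→R x h)

  opaque
    -- An arc leaving the out-neighbourhood `A` of `x` must end at a nonneighbour of `x`, lest it
    -- close a short cycle, hence at `w`. An arc leaving `A ⊕ w` therefore starts at `w`, and its
    -- end `t`, adjacent to `x` but outside `A`, has an arc to `x`.
    bottleneck : ∀ {G x} → Strong G → Nontrivial G → x ∈ G → miss x G ≤ 1 → Bottleneck G x
    bottleneck {G} {x} s nt x∈ few with successor s x∈ (proj₁ (proj₂ (another nt x)))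
        (proj₂ (proj₂ (another nt x)))
    ... | a , a∈ , xa = result (escape s A⊆ (a , ∈⟪⟫⁺ (a∈ , xa)) x∈ x∉A)
      where
      A : Subset n
      A = ⟪ (λ u → (u ∈? G) ×-dec (x ⟶? u)) ⟫
      A⊆ : A ⊆ G
      A⊆ = proj₁ ∘ ∈⟪⟫⁻
      x∉A : x ∉ A
      x∉A h = loopless x (proj₂ (∈⟪⟫⁻ h))
      apart-exit : ∀ {u v} → u ∈ A → v ∈ G → v ∉ A → u ⟶ v → Apart x v
      apart-exit u∈ v∈ v∉ b = (λ { refl → no2 (proj₂ (∈⟪⟫⁻ u∈)) b }) , (λ c → v∉ (∈⟪⟫⁺ (v∈ , c))) ,
          no3 (proj₂ (∈⟪⟫⁻ u∈)) b
      result : (∃ λ u → ∃ λ v → u ∈ A × v ∈ G × v ∉ A × u ⟶ v) → Bottleneck G x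
      result (u , w , u∈ , w∈ , w∉ , uw) with terminal
          (a , ∈⟪⟫⁺ {P? = λ u → (u ∈? G) ×-dec (x ⟶? u)} (a∈ , xa))
        | escape {X = A ⊕ w} s (⊕⊆ A⊆ w∈) (w , ∈⊕ʳ) x∈
            ([ x∉A , proj₁ (apart-exit u∈ w∈ w∉ uw) ]′ ∘ ∈⊕⁻)
      ... | R , R⊆ , ne , c , sR | u′ , t , u′∈ , t∈ , t∉ , u′t = record
        { w = w ; t = t ; R = R
        ; cut = record { R⊆G = A⊆ ∘ R⊆ ; w∈G = w∈ ; w∉R = w∉ ∘ R⊆ ; strong = sR ; inh = ne
        ; exits = exits }
        ; x≁w = x≁w ; x→R = λ v v∈ → proj₂ (∈⟪⟫⁻ (R⊆ v∈)) ; t∈G = t∈ ; w→t = w→t ; t→x = t→x }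
        where
        x≁w : Apart x w
        x≁w = apart-exit u∈ w∈ w∉ uw
        only-w : ∀ {v} → v ∈ G → Apart x v → v ≡ w
        only-w v∈ p = atMostOne few (v∈ , p) (w∈ , x≁w)
        exits : ∀ u v → u ∈ R → v ∈ G → u ⟶ v → v ∈ R ⊎ v ≡ w
        exits u v u∈ v∈ b with v ∈? A
        ... | yes v∈A = inj₁ (c u v u∈ v∈A b)
        ... | no v∉A  = inj₂ (only-w v∈ (apart-exit (R⊆ u∈) v∈ v∉A b))
        w→t : w ⟶ t
        w→t with ∈⊕⁻ u′∈
        ... | inj₁ h = ⊥-elim (t∉ (subst (_∈ A ⊕ w)
            (sym (only-w t∈ (apart-exit h t∈ (t∉ ∘ ∈⊕ˡ) u′t))) ∈⊕ʳ))
        ... | inj₂ e = subst (_⟶ t) e u′t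
        t→x : t ⟶ x
        t→x with adjacency {t} {x} (λ { refl → proj₂ (proj₂ x≁w) w→t })
        ... | out b  = b
        ... | inn b  = ⊥-elim (t∉ (∈⊕ˡ (∈⟪⟫⁺ (t∈ , b))))
        ... | none b = ⊥-elim (⟶⇒≢ w→t (sym (only-w t∈ (Apart-sym b))))

  module _ {G x} (strongG : Strong G) (x∈G : x ∈ G) (bn : Bottleneck G x) where
    open Bottleneck bn
    open Cut cut

    -- Serves the case where `w` has no arc into `R`, so that `R ⊕ w` is not strong: the way back
    -- from `w` to `R` leads through `t` and `x`.
    loop : Subset n
    loop = R ⊕ w ⊕ t ⊕ x

    loop⊆ : loop ⊆ G
    loop⊆ = ⊕⊆ (⊕⊆ (⊕⊆ R⊆G w∈G) t∈G) x∈G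

    loop-strong : Strong loop
    loop-strong X X⊆ (y , y∈) c = ⊕⊆ (⊕⊆ (⊕⊆ (proj₁ Rw) (proj₂ Rw)) t∈X) x∈X
      where
      fromX : x ∈ X → R ⊆ X × w ∈ X
      fromX h with inh
      ... | r , r∈ = closed-exit strongG cut (∈⊕ˡ ∘ ∈⊕ˡ ∘ ∈⊕ˡ) (∈⊕ˡ (∈⊕ˡ ∈⊕ʳ)) c
          (c x r h (∈⊕ˡ (∈⊕ˡ (∈⊕ˡ r∈))) (x→R r r∈)) r∈
      fromT : t ∈ X → R ⊆ X × w ∈ X
      fromT h = fromX (c t x h ∈⊕ʳ t→x)
      Rw : R ⊆ X × w ∈ X
      Rw with ∈⊕⁻ (X⊆ y∈)
      ... | inj₂ refl = fromX y∈
      ... | inj₁ h with ∈⊕⁻ h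
      ...   | inj₂ refl = fromT y∈
      ...   | inj₁ h′ with ∈⊕⁻ h′
      ...     | inj₂ refl = fromT (c w t y∈ (∈⊕ˡ ∈⊕ʳ) w→t)
      ...     | inj₁ y∈R  = closed-exit strongG cut (∈⊕ˡ ∘ ∈⊕ˡ ∘ ∈⊕ˡ) (∈⊕ˡ (∈⊕ˡ ∈⊕ʳ)) c y∈ y∈R
      t∈X : t ∈ X
      t∈X = c w t (proj₂ Rw) (∈⊕ˡ ∈⊕ʳ) w→t
      x∈X : x ∈ X
      x∈X = c t x t∈X ∈⊕ʳ t→x

    -- Each vertex of `R` is missed by `w`, or has an arc to `w` and is then missed by `t`. The
    -- additional 1 is the pair `x`, `w`; the 3 is the number of vertices added.
    loop-excess : ¬ To R w → R ≼[ card R + 1 , 3 ] loop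
    loop-excess ¬to = ≼-weaken _ 3 (≼-trans (≼-trans (≼-⊕ w∉R) (≼-⊕ t∉)) (≼-⊕ x∉))
      (+-monoˡ-≤ 3 (≤-trans (miss+ind strongG cut ¬to)
          (+-monoʳ-≤ (miss w R) (miss-exit strongG cut t∈G t∉R w→t))
        ⊞ ∃⇒# (∈⊕ˡ {H = R ⊕ w} {q = t} ∈⊕ʳ , x≁w)))
      where
      t∉ : t ∉ R ⊕ w
      t∉ = [ t∉R , ⟶⇒≢ w→t ∘ sym ]′ ∘ ∈⊕⁻
      x∉ : x ∉ R ⊕ w ⊕ t
      x∉ = [ [ x∉R , proj₁ x≁w ]′ ∘ ∈⊕⁻ , ⟶⇒≢ t→x ∘ sym ]′ ∘ ∈⊕⁻

  -- Excess plus the in-degree of an exempt vertex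

  cut-of-split : ∀ {G z} → z ∈ G → Split (G ⊖ z) → ∃ λ R → Cut G z R × ∃ λ a → a ∈ G × a ∉ R × a ≢ z
  cut-of-split {G} {z} z∈ (X , X⊆ , ne , c , a , a∈ , a∉) with terminal ne
  ... | R , R⊆ , ne′ , c′ , sR = R , record
    { R⊆G = ⊖⊆ ∘ X⊆ ∘ R⊆ ; w∈G = z∈ ; w∉R = λ h → proj₂ (∈⊖⁻ (X⊆ (R⊆ h))) refl ; strong = sR
    ; inh = ne′ ; exits = exits }
    , a , proj₁ (∈⊖⁻ a∈) , a∉ ∘ R⊆ , proj₂ (∈⊖⁻ a∈)
    where
    exits : ∀ u v → u ∈ R → v ∈ G → u ⟶ v → v ∈ R ⊎ v ≡ z
    exits u v u∈ v∈ b with v ≟ z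
    ... | yes e = inj₂ e
    ... | no v≢z = inj₁ (c′ u v u∈ (c u v (R⊆ u∈) (∈⊖⁺ v∈ v≢z) b) b)

  -- Induction on `G`. In the smaller part the exempt vertex is `z` again, or the only in-neighbour
  -- of `z`, or the exit of a bottleneck: the one vertex that may have lost out-arcs.
  excess+ind≥4 : ∀ {G z} → Strong G → Nontrivial G → z ∈ G → (∀ u → u ∈ G → u ≢ z → 2 ≤ outd u G) →
                 2 * card G + 4 ≤ gaps G + 2 * ind z G
  excess+ind≥4 {G} = go G (⊂-wellFounded G)
    where
    go : ∀ G → Acc _⊂_ G → ∀ {z} → Strong G → Nontrivial G → z ∈ G →
        (∀ u → u ∈ G → u ≢ z → 2 ≤ outd u G) →
         2 * card G + 4 ≤ gaps G + 2 * ind z G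
    go G (acc rec) {z} s nt z∈ out≥2 = cases (strong-or-split (G ⊖ z))
      where
      Goal : Set
      Goal = 2 * card G + 4 ≤ gaps G + 2 * ind z G

      bigger : ∀ {R w} → Strong R → Nontrivial R → 3 ≤ card (R ⊕ w)
      bigger sR ntR = ≤-trans (≤-trans (n≤1+n 3) (four≤card sR ntR)) (card-mono ∈⊕ˡ)

      split : (∃ λ R → Cut G z R × ∃ λ a → a ∈ G × a ∉ R × a ≢ z) → Goal
      split (R , cut , a , a∈ , a∉R , a≢z) with to? R z
      -- `R⁺` omits `a`, so induction applies with the same `z`; neither the excess nor the
      -- in-degree of `z` drops on the way to `G`.
      ... | yes to = arith (gaps R⁺) (card R⁺) (gaps G) (card G) (ind z R⁺) (ind z G)
              (go R⁺ (rec (R⁺⊆G , a , a∈ , [ a∉R , a≢z ]′ ∘ ∈⊕⁻)) (⊕-strong s cut to)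
                (proj₁ ntR , z , ∈⊕ˡ (proj₁ (proj₂ (proj₂ ntR))) , ∈⊕ʳ ,
                  ∈∉⇒≢ (proj₁ (proj₂ (proj₂ ntR))) w∉R) ∈⊕ʳ out⁺)
              (_≼[_,_]_.bound (≼-strong s (⊕-strong s cut to) R⁺⊆G (bigger strong ntR)))
                (ind-mono z R⁺⊆G)
        where
        open Cut cut
        R⁺ = R ⊕ z
        R⁺⊆G : R⁺ ⊆ G
        R⁺⊆G = ⊕⊆ R⊆G z∈
        ntR : Nontrivial R
        ntR = nontrivial s cut (proj₂ inh) (out-R≥1 s cut (proj₂ inh)
            (out≥2 _ (R⊆G (proj₂ inh)) (∈∉⇒≢ (proj₂ inh) w∉R)))
        out⁺ : ∀ u → u ∈ R⁺ → u ≢ z → 2 ≤ outd u R⁺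
        out⁺ u u∈ u≢z = [ (λ h → ≤-trans (out≥2 u (R⊆G h) u≢z) (out-⊕ s cut h)) ,
            (λ e → ⊥-elim (u≢z e)) ]′ (∈⊕⁻ u∈)
        arith : ∀ x h y g p q → 2 * h + 4 ≤ x + 2 * p → x + 2 * g + 2 * 0 ≤ y + 2 * h + 2 * 0 →
            p ≤ q → 2 * g + 4 ≤ y + 2 * q
        arith x h y g p q a b c = farkas 0 (a ⊞ b ⊞ c ⊞ c) (solve (x ∷ h ∷ y ∷ g ∷ p ∷ q ∷ []))
      ... | no ¬to = bound (m≤n⇒m<n∨m≡n (four≤card strong ntR))
        where
        open Cut cut
        ntR : Nontrivial R
        ntR = nontrivial s cut (proj₂ inh) (out-R≥1 s cut (proj₂ inh)
            (out≥2 _ (R⊆G (proj₂ inh)) (∈∉⇒≢ (proj₂ inh) w∉R)))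
        bound : 5 ≤ card R ⊎ 4 ≡ card R → Goal
        -- Attaching `z` gives excess at least `miss z R` - 1, and `miss z R + ind z R` is at least
        -- 5.
        bound (inj₁ r≥5) = arith (gaps R) (card R) (gaps G) (card G) (miss z R) (ind z R)
            (ind z G) r≥5
          (excess≥0 strong ntR)
          (_≼[_,_]_.bound (≼-attach s strong R⊆G (≤-trans (n≤1+n 3) (four≤card strong ntR)) z∈ w∉R
            (exit s cut)))
          (miss+ind s cut ¬to) (ind-mono z R⊆G)
          where
          arith : ∀ x r y g m p q → 5 ≤ r → 2 * r ≤ x + 4 → x + 2 * g + 2 * m ≤ y + 2 * r + 2 * 1 →
              r ≤ m + p → p ≤ q → 2 * g + 4 ≤ y + 2 * q
          arith x r y g m p q a b c d e = farkas 0 (a ⊞ a ⊞ b ⊞ c ⊞ d ⊞ d ⊞ e ⊞ e)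
              (solve (x ∷ r ∷ y ∷ g ∷ m ∷ p ∷ q ∷ []))
        -- Of at least 8 arcs starting in `R` at most 4 stay inside, so the in-degree of `z` alone
        -- is at least 4.
        bound (inj₂ 4≡r) = arith (gaps G) (card G) (card R) (arcsIn R) (ind z R) (ind z G)
            (≤-reflexive 4≡r) (excess≥0 s nt)
          (fourVertices strong ntR (sym 4≡r))
          (≤-trans (arcs-out R z (λ _ → 0) (λ u u∈ → ≤-trans (out≥2 u (R⊆G u∈) (∈∉⇒≢ u∈ w∉R))
            (≤-trans (out-R s cut u∈) (m≤m+n _ 0))))
            (≤-reflexive (cong (arcsIn R + ind z R +_) (trans (∑∈-const R 0) (*-zeroʳ (card R))))))
          (ind-mono z R⊆G)
          where
          arith : ∀ y g r a p q → 4 ≤ r → 2 * g ≤ y + 4 → a ≤ 4 → 2 * r ≤ a + p + 0 → p ≤ q →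
              2 * g + 4 ≤ y + 2 * q
          arith y g r a p q i j k l m = farkas 0 (i ⊞ i ⊞ i ⊞ i ⊞ j ⊞ k ⊞ k ⊞ l ⊞ l ⊞ m ⊞ m)
              (solve (y ∷ g ∷ r ∷ a ∷ p ∷ q ∷ []))

      module StrongRest (sS : Strong (G ⊖ z)) where
        S : Subset n
        S = G ⊖ z
        z∉S : z ∉ S
        z∉S h = proj₂ (∈⊖⁻ h) refl
        card-G : card G ≡ card S + 1
        card-G = trans (cong card (sym (⊖-⊕ z∈))) (card-⊕ z∉S)
        gaps-G : gaps G ≡ gaps S + 2 * miss z S
        gaps-G = trans (cong gaps (sym (⊖-⊕ z∈))) (gaps-⊕ z∉S)
        ntS : Nontrivial S
        ntS with another nt z
        ... | u , u∈ , z≢u = u , proj₁ v , ∈⊖⁺ u∈ (z≢u ∘ sym) , proj₁ (proj₂ v) ,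
            ⟶⇒≢ (proj₂ (proj₂ v))
          where
          v : ∃ λ v → v ∈ S × u ⟶ v
          v = #⇒∃ (arith (outd u S) ([]≤1 (u ⟶? z)) (≤-trans (out≥2 u u∈ (z≢u ∘ sym))
                (≤-trans (≤-reflexive (cong (outd u) (sym (⊖-⊕ z∈))))
                  (≤-reflexive (outd-⊕ u z∉S)))))
            where
            arith : ∀ a {b} → b ≤ 1 → 2 ≤ a + b → 1 ≤ a
            arith a {b} p q = farkas 0 (p ⊞ q) (solve (a ∷ b ∷ []))
        pred : From G z
        pred with enter {X = ⟪ _≟ z ⟫} s (λ h → subst (_∈ G) (sym (∈⟪⟫⁻ h)) z∈) (z , ∈⟪⟫⁺ refl)
          (proj₁ (proj₂ (another nt z))) (λ h → proj₂ (proj₂ (another nt z)) (sym (∈⟪⟫⁻ h)))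
        ... | u , w , u∈ , _ , w∈ , a = u , u∈ , subst (u ⟶_) (∈⟪⟫⁻ w∈) a

        -- Without `z` only its in-neighbour `p` can fall short, so `p` becomes the exempt vertex.
        -- An in-neighbour u of `p` is missed by `z`: z → u closes a triangle, and u → z would be a
        -- second arc into `z`. So `miss z S` replaces `ind p S`, and the 1 lost by adding `z` is
        -- its in-degree.
        oneIn : ind z G ≤ 1 → Goal
        oneIn d≤1 with pred
        ... | p , p∈ , pz = arith (gaps S) (card S) (miss z S) (ind p S) (gaps G) (card G) (ind z G)
            (go S (rec (⊖⊆ , z , z∈ , z∉S)) sS ntS (∈⊖⁺ p∈ (⟶⇒≢ pz)) outS) indp (∃⇒# (p∈ , pz))
              (≤-reflexive card-G) (≤-reflexive (sym gaps-G))
          where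
          outS : ∀ u → u ∈ S → u ≢ p → 2 ≤ outd u S
          outS u u∈ u≢p = ≤-trans (out≥2 u (⊖⊆ u∈) (proj₂ (∈⊖⁻ u∈)))
            (#-mono (λ { v (v∈ , a) → ∈⊖⁺ v∈ (λ { refl → u≢p (atMostOne d≤1 (⊖⊆ u∈ , a) (p∈ , pz))
              }) , a }))
          indp : ind p S ≤ miss z S
          indp = #-mono (λ { u (u∈ , a) → u∈ , ∈∉⇒≢ u∈ z∉S ∘ sym , no3 a pz ,
            (λ b → ⟶⇒≢ a (atMostOne d≤1 (⊖⊆ u∈ , b) (p∈ , pz))) })
          arith : ∀ x r m i y g d → 2 * r + 4 ≤ x + 2 * i → i ≤ m → 1 ≤ d → g ≤ r + 1 →
              x + 2 * m ≤ y → 2 * g + 4 ≤ y + 2 * d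
          arith x r m i y g d a b c e f = farkas 0 (a ⊞ b ⊞ b ⊞ c ⊞ c ⊞ e ⊞ e ⊞ f)
              (solve (x ∷ r ∷ m ∷ i ∷ y ∷ g ∷ d ∷ []))

        module Contradiction (d≥2 : 2 ≤ ind z G) (¬goal : gaps G + 2 * ind z G + 1 ≤ 2 * card G + 4)
          (x : Fin n) (x∈ : x ∈ G) (bn : Bottleneck G x) where
          open Bottleneck bn
          open Cut cut

          -- Excess below 2: the in-degree of `z` already supplies 2 of the 4.
          small : gaps G + 1 ≤ 2 * card G
          small = arith (gaps G) (card G) (ind z G) d≥2 ¬goal
            where
            arith : ∀ y g d → 2 ≤ d → y + 2 * d + 1 ≤ 2 * g + 4 → y + 1 ≤ 2 * g
            arith y g d a b = farkas 0 (a ⊞ a ⊞ b) (solve (y ∷ g ∷ d ∷ []))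

          -- A vertex whose only possible out-neighbour is `w` has to be `z`. The out-neighbours of
          -- `w`, at least two, are then missed by `z`. This bounds the order of `G` by 6, too small
          -- for 2 out-arcs at every other vertex.
          sink : ∀ c → c ∈ R → outd c R ≤ 0 → ⊥
          sink c c∈ out≤0 = arith (gaps S) (card S) (miss z S) (gaps G) (card G) (ind z G)
              (arcsIn G) m≥2 (excess≥0 sS ntS)
              card-G gaps-G ¬goal d≥2 s≤ (arcs-gaps G) arcs≥
            where
            c≡z : c ≡ z
            c≡z = decidable-stable (c ≟ z) (λ c≢z → <⇒≱ (s≤s out≤0)
                (out-R≥1 s cut c∈ (out≥2 c (R⊆G c∈) c≢z)))
            onlyW : ∀ v → v ∈ G → z ⟶ v → v ≡ w
            onlyW v v∈ a with exits c v c∈ v∈ (subst (_⟶ v) (sym c≡z) a)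
            ... | inj₁ v∈R = ⊥-elim (<⇒≱ (∃⇒# {P? = λ u → (u ∈? R) ×-dec (c ⟶? u)}
                (v∈R , subst (_⟶ v) (sym c≡z) a)) out≤0)
            ... | inj₂ e   = e
            next : ∃ λ v → v ∈ G × z ⟶ v
            next = successor s z∈ (proj₁ (proj₂ (another nt z))) (proj₂ (proj₂ (another nt z)))
            z→w : z ⟶ w
            z→w = subst (z ⟶_) (onlyW _ (proj₁ (proj₂ next)) (proj₂ (proj₂ next)))
                (proj₂ (proj₂ next))
            m≥2 : 2 ≤ miss z S
            m≥2 = ≤-trans (out≥2 w w∈G (⟶⇒≢ z→w ∘ sym)) (#-mono (λ { v (v∈ , a) →
              ∈⊖⁺ v∈ (λ { refl → no2 z→w a }) , (λ { refl → no2 z→w a }) ,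
              (λ b → ⟶⇒≢ a (sym (onlyW v v∈ b))) , no3 z→w a }))
            s≤ : card S ≤ 1 + ind z G + miss z S
            s≤ = ≤-trans (≤-reflexive (sym (degrees-∉ z∉S)))
              ((≤-trans (#-mono {Q? = _≟ w} (λ { v (v∈ , a) → onlyW v (⊖⊆ v∈) a }))
                (≤-reflexive (#-≡ w)) ⊞ ind-mono z ⊖⊆) ⊞ ≤-refl)
            arcs≥ : card G * 2 ≤ arcsIn G + 1
            arcs≥ = ≤-trans (≤-reflexive (sym (∑∈-const G 2))) (≤-trans (∑∈-mono G pointwise)
              (≤-trans (≤-reflexive (∑∈-+ G _ _)) (+-monoʳ-≤ (arcsIn G) (∑∈-≟ G z))))
              where
              pointwise : ∀ u → u ∈ G → 2 ≤ outd u G + [ u ≟ z ]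
              pointwise u u∈ with u ≟ z
              ... | no u≢z = ≤-trans (out≥2 u u∈ u≢z) (m≤m+n _ 0)
              ... | yes refl = ∃⇒# {P? = λ v → (v ∈? G) ×-dec (z ⟶? v)} (proj₂ next) ⊞ ≤-refl {1}
            arith : ∀ x r m y g d a → 2 ≤ m → 2 * r ≤ x + 4 → g ≡ r + 1 → y ≡ x + 2 * m →
                y + 2 * d + 1 ≤ 2 * g + 4 → 2 ≤ d →
                    r ≤ 1 + d + m → 2 * a + y + g ≡ g * g → g * 2 ≤ a + 1 → ⊥
            arith x r m _ _ d a m≥2 ex refl refl ng d≥2 r≤ arcs a≥ =
              absurd-≤ 1 (r²≤5r ⊞ ≤-reflexive arcs ⊞ a≥ ⊞ a≥ ⊞ ex ⊞ m≥2 ⊞ m≥2)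
                  (solve (x ∷ r ∷ m ∷ a ∷ []))
              where
              -- The failed goal and the nonnegative excess of `S` leave 2(d + m) ≤ 9, hence d + m ≤
              -- 4.
              r≤5 : r ≤ 5
              r≤5 = ≤-pred (*-cancelˡ-< 2 r 6
                  (farkas 0 (r≤ ⊞ r≤ ⊞ ng ⊞ ex) (solve (x ∷ r ∷ m ∷ d ∷ []))))
              r²≤5r : r * r ≤ 5 * r
              r²≤5r = *-monoˡ-≤ r r≤5

          module NoSink (out≥1 : ∀ c → c ∈ R → 1 ≤ outd c R) where
            ntR : Nontrivial R
            ntR = nontrivial s cut (proj₂ inh) (out≥1 _ (proj₂ inh))
            r≥4 : 4 ≤ card R
            r≥4 = four≤card strong ntR

            -- The loop alone has excess at least `card R` - 2, which is at least 2.
            far : ¬ To R w → ⊥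
            far ¬to = arith (gaps R) (card R) (gaps G) (card G) r≥4 (excess≥0 strong ntR)
                (_≼[_,_]_.bound (≼-trans (loop-excess s x∈ bn ¬to)
                (≼-strong s (loop-strong s x∈ bn) (loop⊆ s x∈ bn)
                  (≤-trans (≤-trans (n≤1+n 3) r≥4) (card-mono (∈⊕ˡ ∘ ∈⊕ˡ ∘ ∈⊕ˡ)))))) small
              where
              arith : ∀ x r y g → 4 ≤ r → 2 * r ≤ x + 4 → x + 2 * g + 2 * (r + 1 + 0) ≤ y + 2 * r +
                  2 * (3 + 0) → y + 1 ≤ 2 * g → ⊥
              arith x r y g a b c d = absurd-≤ 0 (a ⊞ a ⊞ b ⊞ c ⊞ d) (solve (x ∷ r ∷ y ∷ g ∷ []))

            module Near (to : To R w) where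
              H : Subset n
              H = R ⊕ w
              H⊆G : H ⊆ G
              H⊆G = ⊕⊆ R⊆G w∈G
              H⊂G : H ⊂ G
              H⊂G = H⊆G , x , x∈ , [ x∉R , proj₁ x≁w ]′ ∘ ∈⊕⁻
              sH : Strong H
              sH = ⊕-strong s cut to
              ntH : Nontrivial H
              ntH with ntR
              ... | a , b , a∈ , b∈ , a≢b = a , b , ∈⊕ˡ a∈ , ∈⊕ˡ b∈ , a≢b
              attached : gaps H + 2 * card G + 2 * ind w R ≤ gaps G + 2 * card H + 2 * 1
              attached = _≼[_,_]_.bound (cut-attach s cut to ntR t∈G t∉R w→t)
              outR : ∀ u → u ∈ R → u ≢ z → 2 ≤ outd u H
              outR u u∈ u≢z = ≤-trans (out≥2 u (R⊆G u∈) u≢z) (out-⊕ s cut u∈)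

              -- In `H` only the exit `w` may fall short. Exempting it, `attached` converts its
              -- in-degree into excess 3 for `G`.
              z∉ : z ∉ R → ⊥
              z∉ z∉R = arith (gaps H) (card H) (gaps G) (card G) (ind w H) (ind w R)
                (go H (rec H⊂G) sH ntH ∈⊕ʳ (λ u u∈ u≢w → [ (λ h → outR u h (∈∉⇒≢ h z∉R)) ,
                  (λ e → ⊥-elim (u≢w e)) ]′ (∈⊕⁻ u∈)))
                (#-mono (λ { u (u∈ , a) → [ id , (λ e → ⊥-elim (⟶⇒≢ a e)) ]′ (∈⊕⁻ u∈) , a }))
                  attached small
                where
                arith : ∀ x h y g i p → 2 * h + 4 ≤ x + 2 * i → i ≤ p →
                    x + 2 * g + 2 * p ≤ y + 2 * h + 2 * 1 → y + 1 ≤ 2 * g → ⊥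
                arith x h y g i p a b c d = absurd-≤ 2 (a ⊞ b ⊞ b ⊞ c ⊞ d)
                    (solve (x ∷ h ∷ y ∷ g ∷ i ∷ p ∷ []))

              -- `w` keeps two out-arcs in `H`, so `z` remains the only exempt vertex and the bound
              -- passes from `H` to `G`.
              wide : z ∈ R → 2 ≤ outd w R → ⊥
              wide z∈R w≥2 = arith (gaps H) (card H) (gaps G) (card G) (ind z H) (ind z G)
                (go H (rec H⊂G) sH ntH (∈⊕ˡ z∈R) (λ u u∈ u≢z → [ (λ h → outR u h u≢z) ,
                  (λ e → subst (λ u → 2 ≤ outd u H) (sym e) (≤-trans w≥2 (outd-mono w ∈⊕ˡ))) ]′
                    (∈⊕⁻ u∈)))
                (ind-mono z H⊆G) (_≼[_,_]_.bound (≼-strong s sH H⊆G (bigger strong ntR))) ¬goal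
                where
                arith : ∀ x h y g i p → 2 * h + 4 ≤ x + 2 * i → i ≤ p →
                    x + 2 * g + 2 * 0 ≤ y + 2 * h + 2 * 0 → y + 2 * p + 1 ≤ 2 * g + 4 → ⊥
                arith x h y g i p a b c d = absurd-≤ 0 (a ⊞ b ⊞ b ⊞ c ⊞ d)
                    (solve (x ∷ h ∷ y ∷ g ∷ i ∷ p ∷ []))

              -- All but at most one vertex of `R` are missed by `w` or have an arc to it, so adding
              -- `w` and attaching `t` gives excess at least `card R` - 3. Being below 2, this
              -- forces `card R` = 4. Then at least 7 arcs start in `R`, at most 4 stay inside, and
              -- the 3 entering `w` give excess 2.
              narrow : z ∈ R → outd w R ≤ 1 → ⊥
              narrow z∈R w≤1 = arith (gaps H) (card H) (gaps G) (card G) (ind w R) (arcsIn R)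
                  (card R) (excess≥0 sH ntH) attached small
                (≤-reflexive (card-⊕ w∉R)) r≥4 (fourVertices strong ntR (≤-antisym r≤4 r≥4)) arcs≥
                where
                r≤4 : card R ≤ 4
                r≤4 = ≤-pred (*-cancelˡ-< 2 _ _ (arith (gaps R) (card R) (gaps G) (card G)
                    (outd w R) (ind w R) (miss w R) (degrees-∉ w∉R) w≤1 (excess≥0 strong ntR)
                  (subst₂ (λ x h → x + 2 * card G + 2 * ind w R ≤ gaps G + 2 * h + 2 * 1)
                    (gaps-⊕ w∉R) (card-⊕ w∉R) attached) small))
                  where
                  arith : ∀ x r y g o p m → o + p + m ≡ r → o ≤ 1 → 2 * r ≤ x + 4 →
                      x + 2 * m + 2 * g + 2 * p ≤ y + 2 * (r + 1) + 2 * 1 → y + 1 ≤ 2 * g →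
                          2 * r < 2 * 5
                  arith x _ y g o p m refl a b c d = farkas 0 (a ⊞ a ⊞ b ⊞ c ⊞ d)
                      (solve (x ∷ y ∷ g ∷ o ∷ p ∷ m ∷ []))
                arcs≥ : 2 * card R ≤ arcsIn R + ind w R + 1
                arcs≥ = ≤-trans (arcs-out R w (λ u → [ u ≟ z ]) pointwise) (+-monoʳ-≤ _ (∑∈-≟ R z))
                  where
                  pointwise : ∀ u → u ∈ R → 2 ≤ outd u R + [ u ⟶? w ] + [ u ≟ z ]
                  pointwise u u∈ with u ≟ z
                  ... | no u≢z = ≤-trans (out≥2 u (R⊆G u∈) u≢z)
                      (≤-trans (out-R s cut u∈) (m≤m+n _ 0))
                  ... | yes _  = ≤-trans (out≥1 u u∈) (m≤m+n _ _) ⊞ ≤-refl {1}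
                arith : ∀ x h y g p a r → 2 * h ≤ x + 4 → x + 2 * g + 2 * p ≤ y + 2 * h + 2 * 1 →
                    y + 1 ≤ 2 * g → h ≤ r + 1 → 4 ≤ r → a ≤ 4 → 2 * r ≤ a + p + 1 → ⊥
                arith x h y g p a r i j k l m o q =
                    absurd-≤ 0 (i ⊞ j ⊞ k ⊞ m ⊞ m ⊞ m ⊞ m ⊞ o ⊞ o ⊞ q ⊞ q)
                        (solve (x ∷ h ∷ y ∷ g ∷ p ∷ a ∷ r ∷ []))

              absurd : ⊥
              absurd with z ∈? R | 2 ≤? outd w R
              ... | no z∉R  | _     = z∉ z∉R
              ... | yes z∈R | yes h = wide z∈R h
              ... | yes z∈R | no h  = narrow z∈R (≤-pred (≰⇒> h))

            absurd : ⊥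
            absurd with to? R w
            ... | yes to = Near.absurd to
            ... | no ¬to = far ¬to

          absurd : ⊥
          absurd with any? (λ c → (c ∈? R) ×-dec (outd c R ≤? 0))
          ... | yes (c , c∈ , h) = sink c c∈ h
          ... | no ¬c = NoSink.absurd (λ c c∈ → ≰⇒> (λ h → ¬c (c , c∈ , h)))

        result : Goal
        result with ind z G ≤? 1 | 2 * card G + 4 ≤? gaps G + 2 * ind z G
        ... | yes d≤1 | _        = oneIn d≤1
        ... | no _    | yes goal = goal
        ... | no d≰1  | no ¬goal = ⊥-elim (poor (any? (λ x → (x ∈? G) ×-dec (miss x G ≤? 1))))
          where
          ¬goal′ : gaps G + 2 * ind z G + 1 ≤ 2 * card G + 4
          ¬goal′ = ≤-trans (≤-reflexive (+-comm _ 1)) (≰⇒> ¬goal)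
          poor : Dec (∃ λ x → x ∈ G × miss x G ≤ 1) → ⊥
          poor (yes (x , x∈ , few)) = Contradiction.absurd (≰⇒> d≰1) ¬goal′ x x∈
              (bottleneck s nt x∈ few)
          poor (no ¬x) = arith (gaps G) (card G) (ind z G) (≰⇒> d≰1) ¬goal′
            (≤-trans (≤-reflexive (sym (∑∈-const G 2)))
              (∑∈-mono G (λ x x∈ → ≰⇒> (λ h → ¬x (x , x∈ , h)))))
            where
            arith : ∀ y g d → 2 ≤ d → y + 2 * d + 1 ≤ 2 * g + 4 → g * 2 ≤ y → ⊥
            arith y g d a b c = absurd-≤ 0 (a ⊞ a ⊞ b ⊞ c) (solve (y ∷ g ∷ d ∷ []))

      cases : Strong (G ⊖ z) ⊎ Split (G ⊖ z) → Goal
      cases (inj₁ sS) = StrongRest.result sS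
      cases (inj₂ sp) = split (cut-of-split z∈ sp)

  -- Excess at least 3 for the whole digraph

  parity : ∀ c → ∃ λ k → c ≡ 2 * k ⊎ c ≡ suc (2 * k)
  parity zero = 0 , inj₁ refl
  parity (suc c) with parity c
  ... | k , inj₁ e = k , inj₂ (cong suc e)
  ... | k , inj₂ e = suc k , inj₁ (trans (cong suc e) (arith k))
    where
    arith : ∀ k → suc (suc (2 * k)) ≡ 2 * suc k
    arith k = solve (k ∷ [])

  -- Read off from `arcs-gaps`, as c² - c is even. It sharpens `gaps` < 2n + 2 to `gaps` ≤ 2n, which
  -- makes the borderline case exactly regular.
  gaps-even : ∀ H → ∃ λ k → gaps H ≡ 2 * k
  gaps-even H with parity (gaps H)
  ... | k , inj₁ e = k , e
  ... | k , inj₂ e = ⊥-elim (odd (card H) (arcsIn H) (parity (card H))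
      (subst (λ g → 2 * arcsIn H + g + card H ≡ card H * card H) e (arcs-gaps H)))
    where
    odd : ∀ c a → (∃ λ j → c ≡ 2 * j ⊎ c ≡ suc (2 * j)) → 2 * a + suc (2 * k) + c ≡ c * c → ⊥
    odd _ a (j , inj₁ refl) h = even≢odd (2 * j * j) (a + k + j)
        (trans (trans (l j) (sym h)) (r a j k))
      where
      l : ∀ j → 2 * (2 * j * j) ≡ 2 * j * (2 * j)
      l j = solve (j ∷ [])
      r : ∀ a j k → 2 * a + suc (2 * k) + 2 * j ≡ suc (2 * (a + k + j))
      r a j k = solve (a ∷ j ∷ k ∷ [])
    odd _ a (j , inj₂ refl) h = even≢odd (a + k + j + 1) (2 * j * j + 2 * j)
        (trans (trans (l a j k) h) (r j))
      where
      l : ∀ a j k → 2 * (a + k + j + 1) ≡ 2 * a + suc (2 * k) + suc (2 * j)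
      l a j k = solve (a ∷ j ∷ k ∷ [])
      r : ∀ j → suc (2 * j) * suc (2 * j) ≡ suc (2 * (2 * j * j + 2 * j))
      r j = solve (j ∷ [])

  another-with : ∀ {P : Fin n → Set} {P? : Decidable P} {u} → 2 ≤ # P? → ∃ λ v → P v × v ≢ u
  another-with {P} {P?} {u} h with any? (λ v → P? v ×-dec ¬? (v ≟ u))
  ... | yes w = w
  ... | no ¬w = ⊥-elim (absurd-≤ 0 (≤-trans h
      (≤-trans (#-mono (λ v p → decidable-stable (v ≟ u) (λ v≢u → ¬w (v , p , v≢u))))
          (≤-reflexive (#-≡ u)))) refl)

  -- Excess at least 3, doubled because `gaps` counts ordered pairs.
  Goal : Set
  Goal = 2 * card (⊤ {n}) + 2 ≤ gaps ⊤

  module Whole (s : Strong ⊤) (nt : Nontrivial ⊤) (out≥2 : ∀ u → 2 ≤ outd u ⊤) where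

    module _ {w R} (cut : Cut ⊤ w R) where
      open Cut cut

      ntR : Nontrivial R
      ntR = nontrivial s cut (proj₂ inh) (out-R≥1 s cut (proj₂ inh) (out≥2 _))

      r≥4 : 4 ≤ card R
      r≥4 = four≤card strong ntR

      ind≥4 : card R ≡ 4 → 4 ≤ ind w R
      ind≥4 r≡4 = arith (card R) (arcsIn R) (ind w R) r≥4 (fourVertices strong ntR r≡4)
        (≤-trans (arcs-out R w (λ _ → 0) (λ u u∈ → ≤-trans (out≥2 u)
            (≤-trans (out-R s cut u∈) (m≤m+n _ 0))))
          (≤-reflexive (cong (arcsIn R + ind w R +_) (trans (∑∈-const R 0) (*-zeroʳ (card R))))))
        where
        arith : ∀ r a p → 4 ≤ r → a ≤ 4 → 2 * r ≤ a + p + 0 → 4 ≤ p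
        arith r a p i j k = farkas 0 (i ⊞ i ⊞ j ⊞ k) (solve (r ∷ a ∷ p ∷ []))

      -- With `w` exempt, `R ⊕ w` has excess plus in-degree of `w` at least 4, and attaching `t`
      -- turns that in-degree into nonneighbours at a loss of 1.
      near : ∀ {t} → To R w → t ∉ R → w ⟶ t → Goal
      near to t∉ a = arith (gaps (R ⊕ w)) (card (R ⊕ w)) (gaps ⊤) (card ⊤) (ind w (R ⊕ w)) (ind w R)
        (excess+ind≥4 (⊕-strong s cut to) (proj₁ ntR , w , ∈⊕ˡ (proj₁ (proj₂ (proj₂ ntR))) , ∈⊕ʳ ,
            ∈∉⇒≢ (proj₁ (proj₂ (proj₂ ntR))) w∉R) ∈⊕ʳ
          (λ u u∈ u≢w → [ (λ h → ≤-trans (out≥2 u) (out-⊕ s cut h)) , (λ e → ⊥-elim (u≢w e)) ]′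
            (∈⊕⁻ u∈)))
        (#-mono (λ { u (u∈ , b) → [ id , (λ e → ⊥-elim (⟶⇒≢ b e)) ]′ (∈⊕⁻ u∈) , b }))
        (_≼[_,_]_.bound (cut-attach s cut to ntR ∈⊤ t∉ a))
        where
        arith : ∀ x h y g i p → 2 * h + 4 ≤ x + 2 * i → i ≤ p → x + 2 * g + 2 * p ≤ y + 2 * h + 2 *
            1 → 2 * g + 2 ≤ y
        arith x h y g i p a b c = farkas 0 (a ⊞ b ⊞ b ⊞ c) (solve (x ∷ h ∷ y ∷ g ∷ i ∷ p ∷ []))

    few-gaps : ∀ {x} → miss x ⊤ ≤ 1 → Goal
    few-gaps {x} few = cases (to? R w) (m≤n⇒m<n∨m≡n (r≥4 cut))
      where
      bn : Bottleneck ⊤ x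
      bn = bottleneck s nt ∈⊤ few
      open Bottleneck bn
      open Cut cut
      K : Subset n
      K = loop s ∈⊤ bn
      k≥3 : 3 ≤ card K
      k≥3 = ≤-trans (≤-trans (n≤1+n 3) (r≥4 cut)) (card-mono (∈⊕ˡ ∘ ∈⊕ˡ ∘ ∈⊕ˡ))
      cases : Dec (To R w) → 4 < card R ⊎ 4 ≡ card R → Goal
      cases (yes to) _ = near cut to t∉R w→t
      cases (no ¬to) (inj₁ r≥5) = arith (gaps R) (card R) (gaps ⊤) (card ⊤) r≥5
          (excess≥0 strong (ntR cut))
        (_≼[_,_]_.bound (≼-trans (loop-excess s ∈⊤ bn ¬to)
            (≼-strong s (loop-strong s ∈⊤ bn) (loop⊆ s ∈⊤ bn) k≥3)))
        where
        arith : ∀ x r y g → 5 ≤ r → 2 * r ≤ x + 4 → x + 2 * g + 2 * (r + 1 + 0) ≤ y + 2 * r + 2 *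
            (3 + 0) → 2 * g + 2 ≤ y
        arith x r y g a b c = farkas 0 (a ⊞ a ⊞ b ⊞ c) (solve (x ∷ r ∷ y ∷ g ∷ []))
      -- The loop now yields only excess 2. A second out-neighbour t′ of `w` lies outside the loop
      -- and misses the 4 in-neighbours of `w` in `R`, which more than closes the difference.
      cases (no ¬to) (inj₂ 4≡r) with another-with {P? = λ u → (u ∈? ⊤) ×-dec (w ⟶? u)} {t} (out≥2 w)
      ... | t′ , (_ , w→t′) , t′≢t = arith (gaps R) (card R) (gaps ⊤) (card ⊤) (miss t′ K)
          (≤-reflexive 4≡r)
          (excess≥0 strong (ntR cut)) (≤-trans (ind≥4 cut (sym 4≡r)) isolated)
          (_≼[_,_]_.bound (≼-trans (loop-excess s ∈⊤ bn ¬to)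
            (≼-attach s (loop-strong s ∈⊤ bn) (loop⊆ s ∈⊤ bn) k≥3 ∈⊤ t′∉K
            (w , ∈⊕ˡ (∈⊕ˡ ∈⊕ʳ) , w→t′))))
        where
        t′∉R : t′ ∉ R
        t′∉R h = ¬to (t′ , h , w→t′)
        t′∉K : t′ ∉ K
        t′∉K = [ [ [ t′∉R , ⟶⇒≢ w→t′ ∘ sym ]′ ∘ ∈⊕⁻ , t′≢t ]′ ∘ ∈⊕⁻ ,
            (λ { refl → proj₂ (proj₂ x≁w) w→t′ }) ]′ ∘ ∈⊕⁻
        isolated : ind w R ≤ miss t′ K
        isolated = ≤-trans (miss-exit s cut ∈⊤ t′∉R w→t′) (miss-mono t′ (∈⊕ˡ ∘ ∈⊕ˡ))
        arith : ∀ x r y g m → 4 ≤ r → 2 * r ≤ x + 4 → 4 ≤ m → x + 2 * g + 2 *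
            (r + 1 + m) ≤ y + 2 * r + 2 * (3 + 1) → 2 * g + 2 ≤ y
        arith x r y g m a b c d = farkas 4 (a ⊞ a ⊞ b ⊞ c ⊞ c ⊞ d) (solve (x ∷ r ∷ y ∷ g ∷ m ∷ []))

    cut-vertex : ∀ {z} → (∀ v → miss v ⊤ ≤ 2) → Split (⊤ ⊖ z) → Goal
    cut-vertex {z} few sp with cut-of-split ∈⊤ sp
    ... | R , cut , a , a∈ , a∉R , a≢z with to? R z
    ...   | yes to = onward (escape s (⊕⊆ R⊆G ∈⊤) (z , ∈⊕ʳ) a∈ ([ a∉R , a≢z ]′ ∘ ∈⊕⁻))
      where
      open Cut cut
      onward : (∃ λ u → ∃ λ t → u ∈ R ⊕ z × t ∈ ⊤ × t ∉ R ⊕ z × u ⟶ t) → Goal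
      onward (u , t , u∈ , t∈ , t∉ , b) with ∈⊕⁻ u∈
      ... | inj₂ refl = near cut to (t∉ ∘ ∈⊕ˡ) b
      ... | inj₁ h    = ⊥-elim ([ t∉ ∘ ∈⊕ˡ , (λ { refl → t∉ ∈⊕ʳ }) ]′ (exits u t h t∈ b))
    -- A vertex of `R` is missed by `z` or, having an arc to `z`, by `t`; so `R` has at most 2 + 2
    -- vertices. But a four-vertex `R` sends 4 arcs to `z`, giving `t` four nonneighbours.
    ...   | no ¬to with successor s ∈⊤ a∈ (a≢z ∘ sym)
    ...     | t , t∈ , z→t = ⊥-elim (absurd-≤ 1 (≤-trans (ind≥4 cut r≡4) P≤2) refl)
      where
      open Cut cut
      P≤2 : ind z R ≤ 2
      P≤2 = ≤-trans (miss-exit s cut t∈ (λ h → ¬to (t , h , z→t)) z→t)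
          (≤-trans (miss-mono t (λ _ → ∈⊤)) (few t))
      r≡4 : card R ≡ 4
      r≡4 = ≤-antisym (≤-trans (miss+ind s cut ¬to)
          (≤-trans (miss-mono z (λ _ → ∈⊤)) (few z) ⊞ P≤2)) (r≥4 cut)

  -- The complement graph is 2-regular.
  module Regular (n≥10 : 10 ≤ card (⊤ {n})) (out≥2 : ∀ u → 2 ≤ outd u ⊤)
    (few : ∀ v → miss v ⊤ ≤ 2) (many : ∀ v → 2 ≤ miss v ⊤) (noCut : ∀ z → Strong (⊤ ⊖ z)) where

    Nonneighbours : Fin n → Fin n → Fin n → Set
    Nonneighbours x v z = Apart x v × Apart x z × v ≢ z × (∀ u → Apart x u → u ≡ v ⊎ u ≡ z)

    nonneighbours : ∀ x → ∃ λ v → ∃ λ z → Nonneighbours x v z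
    nonneighbours x with #⇒∃ (≤-trans (s≤s z≤n) (many x))
    ... | v , _ , xv with another-with {u = v} (many x)
    ...   | z , (_ , xz) , z≢v = v , z , xv , xz , z≢v ∘ sym , only
      where
      only : ∀ u → Apart x u → u ≡ v ⊎ u ≡ z
      only u xu with u ≟ v | u ≟ z
      ... | yes e | _     = inj₁ e
      ... | no _  | yes e = inj₂ e
      ... | no u≢v | no u≢z = ⊥-elim (absurd-≤ 0
          (≤-trans (≤-trans (≤-reflexive (sym (cong₂ _+_ (#-≡ u) (cong₂ _+_ (#-≡ v) (#-≡ z)))))
        (≤-trans (+-monoʳ-≤ (# (_≟ u)) (#-disjoint {P? = _≟ v} {Q? = _≟ z} {R? = λ y → (y ≟ v) ⊎-dec
            (y ≟ z)} (λ _ → inj₁) (λ _ → inj₂) (λ { _ refl e → z≢v (sym e) })))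
          (#-disjoint {P? = _≟ u} (λ { _ refl → ∈⊤ , xu }) (λ { _ (inj₁ refl) → ∈⊤ , xv
          ; _ (inj₂ refl) → ∈⊤ , xz })
            (λ { _ refl (inj₁ e) → u≢v e ; _ refl (inj₂ e) → u≢z e })))) (few x)) refl)

    other : ∀ {z x} → Apart z x → ∃ λ y → Apart z y × x ≢ y × (∀ u → Apart z u → u ≡ x ⊎ u ≡ y)
    other {z} {x} zx with nonneighbours z
    ... | p , q , zp , zq , p≢q , only with only x zx
    ...   | inj₁ refl = q , zq , p≢q , only
    ...   | inj₂ refl = p , zp , p≢q ∘ sym , λ u h → [ inj₂ , inj₁ ]′ (only u h)

    module Pair {x v z} (nn : Nonneighbours x v z) where
      xv = proj₁ nn
      xz = proj₁ (proj₂ nn)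
      v≢z = proj₁ (proj₂ (proj₂ nn))
      only = proj₂ (proj₂ (proj₂ nn))

      A : Subset n
      A = ⟪ (x ⟶?_) ⟫

      v∉A : v ∉ A
      v∉A h = proj₁ (proj₂ xv) (∈⟪⟫⁻ h)

      outA : ∀ {a u} → a ∈ A → a ⟶ u → u ∈ A ⊎ u ≡ v ⊎ u ≡ z
      outA {a} {u} a∈ b with adjacency {x} {u} (λ { refl → no2 (∈⟪⟫⁻ a∈) b })
      ... | out c  = inj₁ (∈⟪⟫⁺ c)
      ... | inn c  = ⊥-elim (no3 (∈⟪⟫⁻ a∈) b c)
      ... | none c = inj₂ (only u c)

      crossing-apart : ∀ {a b} → a ∈ A → a ⟶ v → v ⟶ b → b ⟶ x → Apart b a
      crossing-apart a∈ av vb bx = (λ { refl → no2 av vb }) , no3 av vb ,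
          (λ ab → no3 ab bx (∈⟪⟫⁻ a∈))

      opaque
        -- Since `z` is not a cut vertex, some arc leaves `A ⊕ v` avoiding `z`. It starts at `v`,
        -- and its end is adjacent to `x` without lying in `A`.
        crossing : ∃ λ b → v ⟶ b × b ⟶ x
        crossing with escape {X = A ⊕ v} {v = x} (noCut z)
          (λ h → ∈⊖⁺ ∈⊤ ([ (λ h′ → λ { refl → proj₁ (proj₂ xz) (∈⟪⟫⁻ h′) }) ,
            (λ { refl → v≢z }) ]′ (∈⊕⁻ h)))
          (v , ∈⊕ʳ) (∈⊖⁺ ∈⊤ (proj₁ xz)) ([ loopless x ∘ ∈⟪⟫⁻ , proj₁ xv ]′ ∘ ∈⊕⁻)
        ... | u , b , u∈ , b∈ , b∉ , ub with ∈⊕⁻ u∈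
        ...   | inj₁ u∈A = ⊥-elim ([ b∉ ∘ ∈⊕ˡ , [ (λ { refl → b∉ ∈⊕ʳ }) ,
            proj₂ (∈⊖⁻ b∈) ]′ ]′ (outA u∈A ub))
        ...   | inj₂ refl with adjacency {b} {x} (λ { refl → proj₂ (proj₂ xv) ub })
        ...     | out c  = b , ub , c
        ...     | inn c  = ⊥-elim (b∉ (∈⊕ˡ (∈⟪⟫⁺ c)))
        ...     | none c = ⊥-elim ([ ⟶⇒≢ ub ∘ sym , proj₂ (∈⊖⁻ b∈) ]′ (only b (Apart-sym c)))

      -- All in-neighbours of `v` in `A` are nonneighbours of one and the same `crossing` vertex.
      ind-A : ind v A ≤ 2
      ind-A = ≤-trans (#-mono (λ { a (a∈ , av) → ∈⊤ , crossing-apart a∈ av (proj₁ (proj₂ crossing))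
          (proj₂ (proj₂ crossing)) })) (few (proj₁ crossing))

      -- b is the tail of an arc that enters {u : u → x, u → z, ¬ v → u} after the second
      -- nonneighbour of z has been deleted.
      opaque
        detour : (∃ λ u → u ⟶ x × u ⟶ v × u ⟶ z) → ∃ λ b → b ⟶ x × v ⟶ b × b ⟶ z
        detour (b* , bx , bv , bz) with other (Apart-sym xz)
        ... | y , zy , x≢y , only-z
          with enter {X = ⟪ (λ u → (u ⟶? x) ×-dec (u ⟶? z) ×-dec ¬? (v ⟶? u)) ⟫} {v = x} (noCut y)
            (λ h → ∈⊖⁺ ∈⊤ (λ { refl → proj₂ (proj₂ zy) (proj₁ (proj₂ (∈⟪⟫⁻ h))) }))
            (b* , ∈⟪⟫⁺ (bx , bz , no2 bv)) (∈⊖⁺ ∈⊤ x≢y) (loopless x ∘ proj₁ ∘ ∈⟪⟫⁻)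
        ...   | u , w , u∈ , u∉ , w∈ , uw with ∈⟪⟫⁻ w∈
        ...     | wx , wz , ¬vw with adjacency {u} {x} (λ { refl → no2 uw wx })
        ...       | inn c  = ⊥-elim (no3 c uw wx)
        ...       | none c = ⊥-elim ([ (λ { refl → ¬vw uw }) , (λ { refl → no2 uw wz }) ]′
            (only u (Apart-sym c)))
        ...       | out ux with adjacency {u} {z} (λ { refl → proj₂ (proj₂ xz) ux })
        ...         | inn c  = ⊥-elim (no3 c uw wz)
        ...         | none c = ⊥-elim ([ (λ { refl → loopless x ux }) ,
            proj₂ (∈⊖⁻ u∈) ]′ (only-z u (Apart-sym c)))
        ...         | out uz = u , ux , decidable-stable (v ⟶? u) (λ h → u∉ (∈⟪⟫⁺ (ux , uz , h))) ,
            uz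

      -- A detour b from v to z misses both A ∩ N⁻(v) and any detour b′ from z to v.
      detours-clash : (∃ λ b → b ⟶ x × v ⟶ b × b ⟶ z) → (∃ λ b → b ⟶ x × z ⟶ b × b ⟶ v) →
          ¬ (2 ≤ ind v A)
      detours-clash (b , bx , vb , bz) (b′ , b′x , zb′ , b′v) two =
          absurd-≤ 0 (≤-trans (two ⊞ ≤-reflexive (sym (#-≡ b′)))
        (≤-trans (#-disjoint {Q? = _≟ b′} {R? = λ u → (u ∈? ⊤) ×-dec apart? b u}
          (λ { a (a∈ , av) → ∈⊤ , crossing-apart a∈ av vb bx })
          (λ { _ refl → ∈⊤ , (λ { refl → no2 vb b′v }) , (λ bb′ → no3 bb′ b′v vb) ,
            (λ b′b → no3 b′b bz zb′) })
          (λ { _ (a∈ , _) refl → no2 (∈⟪⟫⁻ a∈) b′x })) (few b))) refl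

    swap : ∀ {x v z} → Nonneighbours x v z → Nonneighbours x z v
    swap (a , b , c , d) = b , a , c ∘ sym , λ u h → [ inj₂ , inj₁ ]′ (d u h)

    module Vertex {x v z} (nn : Nonneighbours x v z) where
      open Pair nn
      module Other = Pair (swap nn)

      A-card : card A ≡ outd x ⊤
      A-card = ≤-antisym (#-mono (λ u h → ∈⊤ , ∈⟪⟫⁻ h)) (#-mono (λ u h → ∈⟪⟫⁺ (proj₂ h)))

      out-A : ∀ a → a ∈ A → outd a ⊤ ≤ outd a A + [ a ⟶? v ] + [ a ⟶? z ]
      out-A a a∈ = ≤-trans (#-mono (λ { u (_ , b) →
          [ ∈⊕ˡ ∘ ∈⊕ˡ , [ (λ { refl → ∈⊕ˡ ∈⊕ʳ }) , (λ { refl → ∈⊕ʳ }) ]′ ]′ (outA a∈ b) , b }))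
        (≤-reflexive (trans (outd-⊕ {A ⊕ v} a ([ Other.v∉A , v≢z ∘ sym ]′ ∘ ∈⊕⁻))
            (cong (_+ [ a ⟶? z ]) (outd-⊕ a v∉A))))

      sum-A : ∀ k → (∀ a → a ∈ A → k ≤ outd a ⊤) → card A * k ≤ arcsIn A + ind v A + ind z A
      sum-A k h = ≤-trans (≤-reflexive (sym (∑∈-const A k)))
          (≤-trans (∑∈-mono A (λ a a∈ → ≤-trans (h a a∈) (out-A a a∈)))
        (≤-reflexive (trans (∑∈-+ A _ _) (cong₂ _+_
            (trans (∑∈-+ A _ _) (cong (arcsIn A +_) (∑∈-# A (_⟶? v)))) (∑∈-# A (_⟶? z))))))

      -- δ² ≤ |A(A)| + 4 ≤ δ(δ − 1)/2 + 4 for a minimum out-degree δ = |A|.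
      drop : 3 ≤ outd x ⊤ → ∃ λ a → outd a ⊤ < outd x ⊤
      drop δ≥3 with any? (λ a → (a ∈? A) ×-dec suc (outd a ⊤) ≤? outd x ⊤)
      ... | yes (a , _ , lt) = a , lt
      ... | no ¬a = ⊥-elim (arith (outd x ⊤) (arcsIn A) (gaps A) (ind v A) (ind z A) δ≥3
          (subst (λ c → 2 * arcsIn A + gaps A + c ≡ c * c) A-card (arcs-gaps A))
          (subst (λ c → c * outd x ⊤ ≤ arcsIn A + ind v A + ind z A) A-card
            (sum-A (outd x ⊤) (λ a a∈ → ≮⇒≥ (λ lt → ¬a (a , a∈ , lt)))))
          ind-A Other.ind-A)
        where
        arith : ∀ δ a g i j → 3 ≤ δ → 2 * a + g + δ ≡ δ * δ → δ * δ ≤ a + i + j → i ≤ 2 → j ≤ 2 → ⊥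
        arith δ a g i j δ≥3 e h i≤ j≤ = absurd-≤ (g + 3)
            (3δ≤ ⊞ δ≥3 ⊞ δ≥3 ⊞ δ≥3 ⊞ δ≥3 ⊞ ≤-reflexive e ⊞ h ⊞ h ⊞ i≤ ⊞ i≤ ⊞ j≤ ⊞ j≤)
            (solve (δ ∷ a ∷ g ∷ i ∷ j ∷ []))
          where
          3δ≤ : 3 * δ ≤ δ * δ
          3δ≤ = *-monoˡ-≤ δ δ≥3

      module Two (δ≤2 : outd x ⊤ ≤ 2) where
        A≡2 : card A ≡ 2
        A≡2 = trans A-card (≤-antisym δ≤2 (out≥2 x))

        -- The two vertices of `A` have at least 4 out-arcs, of which at most one stays in `A`.
        inds≥3 : 3 ≤ ind v A + ind z A
        inds≥3 = *-cancelˡ-≤ 2 (≤-pred (farkas-parity (arcsIn A) (gaps A) (ind v A) (ind z A)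
          (subst (λ c → 2 * arcsIn A + gaps A + c ≡ c * c) A≡2 (arcs-gaps A))
          (subst (λ c → c * 2 ≤ arcsIn A + ind v A + ind z A) A≡2 (sum-A 2 (λ a _ → out≥2 a)))))
          where
          farkas-parity : ∀ a g i j → 2 * a + g + 2 ≡ 2 * 2 → 2 * 2 ≤ a + i + j → suc (2 * 3) ≤ suc
              (2 * (i + j))
          farkas-parity a g i j e h = farkas g (≤-reflexive e ⊞ h ⊞ h) (solve (a ∷ g ∷ i ∷ j ∷ []))

        opaque
          both : ∃ λ a → a ∈ A × a ⟶ v × a ⟶ z
          both with any? (λ a → (a ∈? A) ×-dec (a ⟶? v) ×-dec (a ⟶? z))
          ... | yes w = w
          ... | no ¬w = ⊥-elim (absurd-≤ 0 (≤-trans inds≥3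
              (≤-trans (#-disjoint {R? = _∈? A} (λ _ → proj₁) (λ _ → proj₁)
                  (λ { a (a∈ , av) (_ , az) → ¬w (a , a∈ , av , az) })) (≤-reflexive A≡2))) refl)

        -- Order 10 is needed in full here: 10 - 1 - 2 - 2 = 5, and `star` discards up to four of
        -- these in-neighbours.
        in≥5 : 5 ≤ ind x ⊤
        in≥5 = arith (outd x ⊤) (ind x ⊤) (miss x ⊤) (card ⊤) δ≤2 (few x) n≥10
            (degrees-∈ {⊤} {x} ∈⊤)
          where
          arith : ∀ o i m c → o ≤ 2 → m ≤ 2 → 10 ≤ c → o + i + m + 1 ≡ c → 5 ≤ i
          arith o i m _ a b h refl = farkas 0 (a ⊞ b ⊞ h) (solve (o ∷ i ∷ m ∷ []))

        -- One of the two nonneighbours of `y` is `x`, which is not its own in-neighbour.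
        apart-in : ∀ {y} → Apart x y → # (λ u → (u ⟶? x) ×-dec apart? y u) ≤ 1
        apart-in {y} xy = +-cancelʳ-≤ 1 _ 1 (≤-trans
            (≤-reflexive (cong (# (λ u → (u ⟶? x) ×-dec apart? y u) +_) (sym (#-≡ x))))
          (≤-trans (#-disjoint {R? = λ u → (u ∈? ⊤) ×-dec apart? y u} (λ _ h → ∈⊤ , proj₂ h)
            (λ { _ refl → ∈⊤ , Apart-sym xy })
            (λ { _ (b , _) refl → loopless x b })) (few y)))

        opaque
          -- Take a from `both`. An in-neighbour u of `x` with v → u or z → u is a nonneighbour of
          -- a; this excludes at most 2. At most one more misses `v` and one more misses `z`, which
          -- leaves a fifth.
          star : ∃ λ u → u ⟶ x × u ⟶ v × u ⟶ z
          star with both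
          ... | a , a∈ , av , az = #⇒∃ {P? = λ u → (u ⟶? x) ×-dec (u ⟶? v) ×-dec (u ⟶? z)}
              (arith _ _ _ _ _ in≥5
              (#-cover {Q? = λ u → (u ∈? ⊤) ×-dec apart? a u} {R? = Later?} cover₁) (few a)
              (#-cover {Q? = λ u → (u ⟶? x) ×-dec apart? v u} {R? = Latest?} (λ _ → id))
                (apart-in xv)
              (#-cover {Q? = λ u → (u ⟶? x) ×-dec apart? z u} (λ _ → id)) (apart-in xz))
            where
            Latest? : Decidable (λ u → (u ⟶ x × Apart z u) ⊎ (u ⟶ x × u ⟶ v × u ⟶ z))
            Latest? = λ u → ((u ⟶? x) ×-dec apart? z u) ⊎-dec
                ((u ⟶? x) ×-dec (u ⟶? v) ×-dec (u ⟶? z))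
            Later? : Decidable (λ u → (u ⟶ x × Apart v u) ⊎ (u ⟶ x × Apart z u) ⊎
                (u ⟶ x × u ⟶ v × u ⟶ z))
            Later? = λ u → ((u ⟶? x) ×-dec apart? v u) ⊎-dec Latest? u
            cover₁ : ∀ u → u ∈ ⊤ × u ⟶ x → (u ∈ ⊤ × Apart a u) ⊎
                ((u ⟶ x × Apart v u) ⊎ ((u ⟶ x × Apart z u) ⊎ (u ⟶ x × u ⟶ v × u ⟶ z)))
            cover₁ u (_ , ux) with adjacency {v} {u} (λ { refl → proj₂ (proj₂ xv) ux })
            ... | out vu  = inj₁ (∈⊤ , Apart-sym (crossing-apart a∈ av vu ux))
            ... | none vu = inj₂ (inj₁ (ux , vu))
            ... | inn uv with adjacency {z} {u} (λ { refl → proj₂ (proj₂ xz) ux })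
            ...   | out zu  = inj₁ (∈⊤ , Apart-sym (Other.crossing-apart a∈ az zu ux))
            ...   | none zu = inj₂ (inj₂ (inj₁ (ux , zu)))
            ...   | inn uz  = inj₂ (inj₂ (inj₂ (ux , uv , uz)))
            arith : ∀ p q r s t {i m} → 5 ≤ i → i ≤ m + p → m ≤ 2 → p ≤ q + r → q ≤ 1 → r ≤ s + t →
                s ≤ 1 → 1 ≤ t
            arith p q r s t {i} {m} a b c d e f g = farkas 0 (a ⊞ b ⊞ c ⊞ d ⊞ e ⊞ f ⊞ g)
                (solve (p ∷ q ∷ r ∷ s ∷ t ∷ i ∷ m ∷ []))

        absurd : ⊥
        absurd with star
        -- By `inds≥3` one of `v` and `z` has two in-neighbours in `A`; these and the opposite
        -- detour are three nonneighbours of one vertex.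
        ... | u , ux , uv , uz with 2 ≤? ind v A
        ...   | yes h = detours-clash (detour (u , ux , uv , uz)) (Other.detour (u , ux , uz , uv))
            h
        ...   | no h  = Other.detours-clash (Other.detour (u , ux , uz , uv))
            (detour (u , ux , uv , uz))
                (arith (ind v A) (ind z A) inds≥3 (≰⇒> h))
          where
          arith : ∀ i j → 3 ≤ i + j → suc i ≤ 2 → 2 ≤ j
          arith i j a b = farkas 0 (a ⊞ b) (solve (i ∷ j ∷ []))

    -- The out-degree falls strictly along `drop` until it reaches 2, where `Two` gives the
    -- contradiction.
    descend : ∀ x → Acc _<_ (outd x ⊤) → ⊥
    descend x (acc rec) with nonneighbours x | outd x ⊤ ≤? 2
    ... | v , z , nn | yes δ≤2 = Vertex.Two.absurd nn δ≤2
    ... | v , z , nn | no δ≰2 with Vertex.drop nn (≰⇒> δ≰2)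
    ...   | a , lt = descend a (rec lt)

  -- Combination of the cases

  nontrivial-⊤ : (∀ u → 2 ≤ outd u ⊤) → Fin n → Nontrivial ⊤
  nontrivial-⊤ out≥2 v with #⇒∃ (≤-trans (s≤s z≤n) (out≥2 v))
  ... | w , w∈ , a = v , w , ∈⊤ , w∈ , ⟶⇒≢ a

  manyGaps : Strong ⊤ → (∀ u → 2 ≤ outd u ⊤) → 10 ≤ card (⊤ {n}) → Goal
  manyGaps s out≥2 n≥10 with any? (λ x → miss x ⊤ ≤? 1) | #⇒∃ {P? = _∈? ⊤ {n}}
      (≤-trans (s≤s z≤n) n≥10)
  ... | yes (x , few) | v , _ = Whole.few-gaps s (nontrivial-⊤ out≥2 v) out≥2 few
  ... | no ¬few | v , _ = decidable-stable (_ ≤? _) contra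
    where
    many : ∀ u → 2 ≤ miss u ⊤
    many u = ≰⇒> (λ h → ¬few (u , h))
    contra : ¬ Goal → ⊥
    contra ¬goal = Regular.descend n≥10 out≥2 few many noCut v (<-wellFounded _)
      where
      total : gaps ⊤ ≤ 2 * card (⊤ {n})
      total with gaps-even ⊤
      ... | k , e = subst (_≤ 2 * card (⊤ {n})) (sym e)
          (*-monoʳ-≤ 2 (≤-pred (*-cancelˡ-< 2 k (suc (card ⊤))
              (≤-trans (≰⇒> (λ h → ¬goal (≤-trans h (≤-reflexive (sym e)))))
                (≤-reflexive (arith (card ⊤)))))))
        where
        arith : ∀ c → 2 * c + 2 ≡ 2 * suc c
        arith c = solve (c ∷ [])
      -- With at least 2 nonneighbours everywhere, a third one at `u` would push `gaps` above
      -- `total`.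
      few : ∀ u → miss u ⊤ ≤ 2
      few u = decidable-stable (_ ≤? _) λ h →
          absurd-≤ 0 (≤-trans (≤-trans lower (∑∈-mono ⊤ (pointwise (≰⇒> h)))) total)
              (arith (card ⊤))
        where
        arith : ∀ c → c * 2 + 1 ≡ 2 * c + 1
        arith c = solve (c ∷ [])
        pointwise : 2 < miss u ⊤ → ∀ y → y ∈ ⊤ → 2 + [ y ≟ u ] ≤ miss y ⊤
        pointwise h y _ with y ≟ u
        ... | yes refl = h
        ... | no _ = many y
        lower : card (⊤ {n}) * 2 + 1 ≤ ∑∈ ⊤ (λ y → 2 + [ y ≟ u ])
        lower = ≤-trans (+-mono-≤ (≤-reflexive (sym (∑∈-const ⊤ 2)))
            (≤-trans (∃⇒# (∈⊤ , refl)) (≤-reflexive (sym (∑∈-# ⊤ (_≟ u))))))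
          (≤-reflexive (sym (∑∈-+ ⊤ _ _)))
      noCut : ∀ z → Strong (⊤ ⊖ z)
      noCut z with strong-or-split (⊤ ⊖ z)
      ... | inj₁ sz = sz
      ... | inj₂ sp = ⊥-elim (¬goal (Whole.cut-vertex s (nontrivial-⊤ out≥2 v) out≥2 few sp))

-- Arc and degree counts of the definitions as sums

count : ∀ {n} → (Fin n → Bool) → ℕ
count p = sum (λ i → [ T? (p i) ])

length-filterᵇ-tabulate : ∀ {A : Set} {n} (p : A → Bool) (f : Fin n → A) →
                          length (filterᵇ p (List.tabulate f)) ≡ count (p ∘ f)
length-filterᵇ-tabulate {n = zero}  p f = refl
length-filterᵇ-tabulate {n = suc n} p f with p (f zero)
... | true  = cong suc (length-filterᵇ-tabulate p (f ∘ suc))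
... | false = length-filterᵇ-tabulate p (f ∘ suc)

length-filterᵇ-++ : ∀ {A : Set} (p : A → Bool) xs ys →
                    length (filterᵇ p (xs ++ ys)) ≡ length (filterᵇ p xs) + length (filterᵇ p ys)
length-filterᵇ-++ p []       ys = refl
length-filterᵇ-++ p (x ∷ xs) ys with p x
... | true  = cong suc (length-filterᵇ-++ p xs ys)
... | false = length-filterᵇ-++ p xs ys

length-filterᵇ-map : ∀ {A B : Set} (p : B → Bool) (f : A → B) xs →
                     length (filterᵇ p (map f xs)) ≡ length (filterᵇ (p ∘ f) xs)
length-filterᵇ-map p f [] = refl
length-filterᵇ-map p f (x ∷ xs) with p (f x)
... | true  = cong suc (length-filterᵇ-map p f xs)
... | false = length-filterᵇ-map p f xs

length-filterᵇ-product : ∀ {A B : Set} {m n} (p : A × B → Bool) (f : Fin m → A) (g : Fin n → B) →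
                         length (filterᵇ p (cartesianProduct (List.tabulate f) (List.tabulate g))) ≡
                         sum (λ i → count (λ j → p (f i , g j)))
length-filterᵇ-product {m = zero}  p f g = refl
length-filterᵇ-product {m = suc m} p f g =
  trans (length-filterᵇ-++ p (map (f zero ,_) (List.tabulate g))
      (cartesianProduct (List.tabulate (f ∘ suc)) (List.tabulate g)))
    (cong₂ _+_ (trans (length-filterᵇ-map p (f zero ,_) (List.tabulate g))
        (length-filterᵇ-tabulate (λ b → p (f zero , b)) g))
               (length-filterᵇ-product p (f ∘ suc) g))

module _ {n : ℕ} (D : Digraph n) where
  open Digraph D

  ∣A∣-sum : ∣A∣ ≡ sum (λ u → count (adj u))
  ∣A∣-sum = length-filterᵇ-product (uncurry adj) id id

  outDegree-count : ∀ v → outDegree v ≡ count (adj v)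
  outDegree-count v = length-filterᵇ-tabulate (adj v) id

  inDegree-count : ∀ v → inDegree v ≡ count (λ u → adj u v)
  inDegree-count v = length-filterᵇ-tabulate (λ u → adj u v) id

pascal : ∀ k → k + k C 2 ≡ suc k C 2
pascal k = trans (cong (_+ k C 2) (sym (nC1≡n k))) (nCk+nC[k+1]≡[n+1]C[k+1] k 1)

2*nC2 : ∀ k → 2 * (k C 2) + k ≡ k * k
2*nC2 zero = refl
2*nC2 (suc k) = arith (k C 2) (suc k C 2) (pascal k) (2*nC2 k)
  where
  shift : ∀ c → 2 * (k + c) + suc k ≡ 2 * c + k + (k + k + 1)
  shift c = solve (k ∷ c ∷ [])
  square : k * k + (k + k + 1) ≡ suc k * suc k
  square = solve (k ∷ [])
  arith : ∀ c c′ → k + c ≡ c′ → 2 * c + k ≡ k * k → 2 * c′ + suc k ≡ suc k * suc k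
  arith c _ refl h = trans (shift c) (trans (cong (_+ (k + k + 1)) h) square)

-- The upper bound

module _ {n : ℕ} (D : Digraph n) (fam : InFamily 3 2 1 D) where
  open Digraph D
  open InFamily fam

  no-2-cycle : ∀ {u v} → Arc u v → ¬ Arc v u
  no-2-cycle {u} {v} a b = free (s≤s (s≤s z≤n)) (s≤s (s≤s z≤n)) y record
    { distinct = inj _ _ ; step = λ { 0F → a } ; close = b }
    where
    y : Fin 2 → Fin n
    y 0F = u
    y 1F = v
    inj : ∀ i j → y i ≡ y j → i ≡ j
    inj 0F 0F _ = refl
    inj 0F 1F refl = ⊥-elim (loopless _ a)
    inj 1F 0F refl = ⊥-elim (loopless _ a)
    inj 1F 1F _ = refl

  no-3-cycle : ∀ {u v w} → Arc u v → Arc v w → ¬ Arc w u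
  no-3-cycle {u} {v} {w} a b c = free (s≤s (s≤s z≤n)) (s≤s (s≤s (s≤s z≤n))) y record
    { distinct = inj _ _ ; step = λ { 0F → a ; 1F → b } ; close = c }
    where
    y : Fin 3 → Fin n
    y 0F = u
    y 1F = v
    y 2F = w
    inj : ∀ i j → y i ≡ y j → i ≡ j
    inj 0F 0F _ = refl
    inj 1F 1F _ = refl
    inj 2F 2F _ = refl
    inj 0F 1F refl = ⊥-elim (loopless _ a)
    inj 1F 0F refl = ⊥-elim (loopless _ a)
    inj 1F 2F refl = ⊥-elim (loopless _ b)
    inj 2F 1F refl = ⊥-elim (loopless _ b)
    inj 0F 2F refl = ⊥-elim (loopless _ c)
    inj 2F 0F refl = ⊥-elim (loopless _ c)

  open ShortCycleFree D no-2-cycle no-3-cycle using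
      (_⟶_; _⟶?_; outd; arcsIn; gaps; arcs-gaps; manyGaps) renaming (Strong to Strong′)

  strong-⊤ : Strong′ ⊤
  strong-⊤ X _ (x , x∈) c {u} _ = follow (strong x u) x∈
    where
    follow : ∀ {a b} → Star Arc a b → a ∈ X → b ∈ X
    follow ε h = h
    follow (s ◅ w) h = follow w (c _ _ h ∈⊤ s)

  opaque
    unfolding #_ ∑∈

    card-⊤ : card (⊤ {n}) ≡ n
    card-⊤ = trans (sum-cong-≗ {n} {λ u → [ u ∈? ⊤ ]} {λ _ → 1} (λ u → []-yes {P? = u ∈? ⊤} ∈⊤))
        (ones n)
      where
      ones : ∀ n → sum {n} (λ _ → 1) ≡ n
      ones zero    = refl
      ones (suc n) = cong suc (ones n)

    outd-⊤ : ∀ v → outd v ⊤ ≡ count (adj v)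
    outd-⊤ v = sum-cong-≗ pointwise
      where
      pointwise : ∀ u → [ (u ∈? ⊤) ×-dec (v ⟶? u) ] ≡ [ v ⟶? u ]
      pointwise u = trans ([]-× (u ∈? ⊤) (v ⟶? u))
          (trans (cong (_* [ v ⟶? u ]) ([]-yes {P? = u ∈? ⊤} ∈⊤)) (*-identityˡ _))

    arcsIn-⊤ : arcsIn ⊤ ≡ ∣A∣
    arcsIn-⊤ = trans (sum-cong-≗ pointwise) (sym (∣A∣-sum D))
      where
      pointwise : ∀ u → [ u ∈? ⊤ ] * outd u ⊤ ≡ count (adj u)
      pointwise u = trans (cong (_* outd u ⊤) ([]-yes {P? = u ∈? ⊤} ∈⊤))
          (trans (*-identityˡ _) (outd-⊤ u))

  -- At least n + 1 of the n(n - 1)/2 pairs carry no arc; what is left is rewritten through C(n -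
  -- 1,2).
  arcs-bound : n ≥ 10 → ∣A∣ ≤ ((n ∸ 1) C 2) ∸ 2
  arcs-bound n≥10 = bound n refl
    (manyGaps strong-⊤ (λ v → subst (2 ≤_) (trans (outDegree-count D v) (sym (outd-⊤ v)))
        (minOut v)) (subst (10 ≤_) (sym card-⊤) n≥10))
    (arcs-gaps ⊤)
    where
    bound : ∀ k → k ≡ n → 2 * card (⊤ {n}) + 2 ≤ gaps ⊤ → 2 * arcsIn ⊤ + gaps ⊤ + card
        (⊤ {n}) ≡ card (⊤ {n}) * card (⊤ {n}) → ∣A∣ ≤ ((k ∸ 1) C 2) ∸ 2
    bound zero e _ _ = ⊥-elim (<⇒≱ n≥10 (subst (_≤ 9) e z≤n))
    bound (suc k) e h count = m+n≤o⇒m≤o∸n ∣A∣ {2} {k C 2}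
        (*-cancelˡ-≤ 2 (arith k ∣A∣ (gaps ⊤) (k C 2)
      (subst (λ c → 2 * c + 2 ≤ gaps ⊤) (trans card-⊤ (sym e)) h)
      (≤-reflexive (subst (λ a → 2 * a + gaps ⊤ + suc k ≡ suc k * suc k) arcsIn-⊤
          (subst (λ c → 2 * arcsIn ⊤ + gaps ⊤ + c ≡ c * c) (trans card-⊤ (sym e)) count)))
      (≤-reflexive (sym (2*nC2 k)))))
      where
      arith : ∀ k a g c → 2 * suc k + 2 ≤ g → 2 * a + g + suc k ≤ suc k * suc k →
          k * k ≤ 2 * c + k → 2 * (a + 2) ≤ 2 * c
      arith k a g c p q r = farkas 0 (p ⊞ q ⊞ r) (solve (k ∷ a ∷ g ∷ c ∷ []))

-- The extremal digraphs

-- Vertex 6 is the only nonneighbour of vertex 8.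
outNeighbours : Fin 9 → List ℕ
outNeighbours 0F = 1 ∷ 2 ∷ []
outNeighbours 1F = 2 ∷ 3 ∷ 4 ∷ []
outNeighbours 2F = 3 ∷ 4 ∷ []
outNeighbours 3F = 4 ∷ 5 ∷ []
outNeighbours 4F = 5 ∷ 6 ∷ []
outNeighbours 5F = 0 ∷ 6 ∷ []
outNeighbours 6F = 0 ∷ 7 ∷ []
outNeighbours 7F = 0 ∷ 1 ∷ 2 ∷ 3 ∷ 8 ∷ []
outNeighbours 8F = 0 ∷ 1 ∷ 2 ∷ 3 ∷ 4 ∷ 5 ∷ []

core : Fin 9 → Fin 9 → Bool
core u v = any (_≡ᵇ toℕ v) (outNeighbours u)

-- With a loop at 8, the vertex that is blown up to a transitive tournament.
core⁺ : Fin 9 → Fin 9 → Bool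
core⁺ u v = core u v ∨ ((toℕ u ≡ᵇ 8) ∧ (toℕ v ≡ᵇ 8))

core-loopless : ∀ u → ¬ T (core u u)
core-loopless = from-yes (all? λ u → ¬? (T? (core u u)))

core⊆core⁺ : ∀ u v → T (core u v) → T (core⁺ u v)
core⊆core⁺ = from-yes (all? λ u → all? λ v → T? (core u v) →-dec T? (core⁺ u v))

core-no2 : ∀ u v → T (core u v) → ¬ T (core v u)
core-no2 = from-yes (all? λ u → all? λ v → T? (core u v) →-dec ¬? (T? (core v u)))

core-no3 : ∀ u v w → T (core u v) → T (core v w) → ¬ T (core w u)
core-no3 = from-yes (all? λ u → all? λ v → all? λ w → T? (core u v) →-dec
    (T? (core v w) →-dec ¬? (T? (core w u))))

core⁺-no2 : ∀ v → T (core⁺ 8F v) → ¬ T (core v 8F)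
core⁺-no2 = from-yes (all? λ v → T? (core⁺ 8F v) →-dec ¬? (T? (core v 8F)))

core⁺-no3 : ∀ v w → T (core⁺ 8F v) → T (core⁺ v w) → ¬ T (core w 8F)
core⁺-no3 = from-yes (all? λ v → all? λ w → T? (core⁺ 8F v) →-dec
    (T? (core⁺ v w) →-dec ¬? (T? (core w 8F))))

colour : ∀ m → Fin (m + 9) → Fin 9
colour zero    v       = v
colour (suc m) zero    = 8F
colour (suc m) (suc v) = colour m v

-- Each new vertex is a copy of 8 with arcs to all earlier copies. It misses only vertex 6, so order
-- and nonadjacent pairs both grow by 1 and the excess keeps the value 3 that it has for the core
-- (10 nonadjacent pairs on 9 vertices).
blowup : ∀ m → Fin (m + 9) → Fin (m + 9) → Bool
blowup zero    u       v       = core u v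
blowup (suc m) zero    zero    = false
blowup (suc m) zero    (suc v) = core⁺ 8F (colour m v)
blowup (suc m) (suc u) zero    = core (colour m u) 8F
blowup (suc m) (suc u) (suc v) = blowup m u v

blowup-colour : ∀ m u v → T (blowup m u v) → T (core⁺ (colour m u) (colour m v))
blowup-colour zero    u       v       a = core⊆core⁺ u v a
blowup-colour (suc m) zero    (suc v) a = a
blowup-colour (suc m) (suc u) zero    a = core⊆core⁺ (colour m u) 8F a
blowup-colour (suc m) (suc u) (suc v) a = blowup-colour m u v a

blowup-loopless : ∀ m u → ¬ T (blowup m u u)
blowup-loopless zero    u       = core-loopless u
blowup-loopless (suc m) zero    = id
blowup-loopless (suc m) (suc u) = blowup-loopless m u

blowup-no2 : ∀ m u v → T (blowup m u v) → ¬ T (blowup m v u)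
blowup-no2 zero    u       v       a b = core-no2 u v a b
blowup-no2 (suc m) zero    (suc v) a b = core⁺-no2 (colour m v) a b
blowup-no2 (suc m) (suc u) zero    a b = core⁺-no2 (colour m u) b a
blowup-no2 (suc m) (suc u) (suc v) a b = blowup-no2 m u v a b

-- A triangle through the newest copy is rotated to start there. Its other two vertices may both be
-- copies of 8, so the arc between them is known only in `core⁺`.
blowup-no3 : ∀ m u v w → T (blowup m u v) → T (blowup m v w) → ¬ T (blowup m w u)
blowup-no3 zero    u       v       w       a b c = core-no3 u v w a b c
blowup-no3 (suc m) zero    (suc v) (suc w) a b c = core⁺-no3 (colour m v) (colour m w) a
    (blowup-colour m v w b) c
blowup-no3 (suc m) (suc u) zero    (suc w) a b c = core⁺-no3 (colour m w) (colour m u) b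
    (blowup-colour m w u c) a
blowup-no3 (suc m) (suc u) (suc v) zero    a b c = core⁺-no3 (colour m u) (colour m v) c
    (blowup-colour m u v a) b
blowup-no3 (suc m) (suc u) (suc v) (suc w) a b c = blowup-no3 m u v w a b c

Blowup : ∀ m → Digraph (m + 9)
Blowup m = record { adj = blowup m ; loopless = blowup-loopless m }

blowup-free : ∀ m → Digraph.C≤_-Free (Blowup m) 3
blowup-free m {zero} (s≤s ())
blowup-free m {1} _ _ y c = blowup-no2 m _ _ (step 0F) close
  where open Digraph.IsDirectedCycle c
blowup-free m {2} _ _ y c = blowup-no3 m _ _ _ (step 0F) (step 1F) close
  where open Digraph.IsDirectedCycle c
blowup-free m {suc (suc (suc _))} _ (s≤s (s≤s (s≤s ())))

sum-colour : ∀ m (f : Fin 9 → ℕ) → sum (f ∘ colour m) ≡ m * f 8F + sum f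
sum-colour zero    f = refl
sum-colour (suc m) f = trans (cong (f 8F +_) (sum-colour m f))
    (sym (+-assoc (f 8F) (m * f 8F) (sum f)))

blowup-out : ∀ m u → 2 ≤ count (blowup m u)
blowup-out zero = from-yes (all? λ u → 2 ≤? count (core u))
blowup-out (suc m) zero = ≤-trans (≤-trans (from-yes (2 ≤? count (core⁺ 8F))) (m≤n+m _ (m * 1)))
  (≤-reflexive (sym (sum-colour m (λ c → [ T? (core⁺ 8F c) ]))))
blowup-out (suc m) (suc u) = ≤-trans (blowup-out m u) (m≤n+m _ _)

blowup-in : ∀ m v → 1 ≤ count (λ u → blowup m u v)
blowup-in zero = from-yes (all? λ v → 1 ≤? count (λ u → core u v))
blowup-in (suc m) zero = ≤-trans (≤-trans (from-yes (1 ≤? count (λ c → core c 8F)))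
    (m≤n+m _ (m * 0)))
  (≤-reflexive (sym (sum-colour m (λ c → [ T? (core c 8F) ]))))
blowup-in (suc m) (suc v) = ≤-trans (blowup-in m v) (m≤n+m _ _)

lift : ∀ m → Fin 9 → Fin (m + 9)
lift zero    c = c
lift (suc m) c = suc (lift m c)

colour-lift : ∀ m c → colour m (lift m c) ≡ c
colour-lift zero    c = refl
colour-lift (suc m) c = colour-lift m c

-- The core has the Hamiltonian cycle 0 1 2 3 4 6 7 8 5.
core-strong : Digraph.Strong (Blowup 0)
core-strong u v = to u ◅◅ from v
  where
  Path = Star (Digraph.Arc (Blowup 0))
  infixr 5 _⇢_
  _⇢_ : ∀ u {v w} {a : Digraph.Arc (Blowup 0) u v} → Path v w → Path u w
  _⇢_ u {a = a} p = a ◅ p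
  to : ∀ u → Path u 0F
  to 0F = ε
  to 1F = 1F ⇢ 2F ⇢ 3F ⇢ 4F ⇢ 6F ⇢ 7F ⇢ 8F ⇢ 5F ⇢ ε
  to 2F = 2F ⇢ 3F ⇢ 4F ⇢ 6F ⇢ 7F ⇢ 8F ⇢ 5F ⇢ ε
  to 3F = 3F ⇢ 4F ⇢ 6F ⇢ 7F ⇢ 8F ⇢ 5F ⇢ ε
  to 4F = 4F ⇢ 6F ⇢ 7F ⇢ 8F ⇢ 5F ⇢ ε
  to 5F = 5F ⇢ ε
  to 6F = 6F ⇢ 7F ⇢ 8F ⇢ 5F ⇢ ε
  to 7F = 7F ⇢ 8F ⇢ 5F ⇢ ε
  to 8F = 8F ⇢ 5F ⇢ ε
  from : ∀ v → Path 0F v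
  from 0F = ε
  from 1F = 0F ⇢ ε
  from 2F = 0F ⇢ 1F ⇢ ε
  from 3F = 0F ⇢ 1F ⇢ 2F ⇢ ε
  from 4F = 0F ⇢ 1F ⇢ 2F ⇢ 3F ⇢ ε
  from 5F = 0F ⇢ 1F ⇢ 2F ⇢ 3F ⇢ 4F ⇢ 6F ⇢ 7F ⇢ 8F ⇢ ε
  from 6F = 0F ⇢ 1F ⇢ 2F ⇢ 3F ⇢ 4F ⇢ ε
  from 7F = 0F ⇢ 1F ⇢ 2F ⇢ 3F ⇢ 4F ⇢ 6F ⇢ ε
  from 8F = 0F ⇢ 1F ⇢ 2F ⇢ 3F ⇢ 4F ⇢ 6F ⇢ 7F ⇢ ε

blowup-strong : ∀ m → Digraph.Strong (Blowup m)
blowup-strong zero = core-strong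
blowup-strong (suc m) = go
  where
  up : ∀ {u v} → Star (Digraph.Arc (Blowup m)) u v → Star (Digraph.Arc (Blowup (suc m))) (suc u)
      (suc v)
  up = gmap suc id
  go : Digraph.Strong (Blowup (suc m))
  go zero    zero    = ε
  -- The new copy is joined to the strong rest by its arc to 0 and by the arc from 7, the only
  -- in-neighbour of 8.
  go zero    (suc v) = subst (T ∘ core⁺ 8F) (sym (colour-lift m 0F)) _ ◅ up
      (blowup-strong m (lift m 0F) v)
  go (suc u) zero    = up (blowup-strong m u (lift m 7F)) ◅◅ subst (λ c → T (core c 8F))
      (sym (colour-lift m 7F)) _ ◅ ε
  go (suc u) (suc v) = up (blowup-strong m u v)

-- The new copy has m + 7 arcs out and one in, and m + 8 is exactly the step from C(m + 8,2) to C(m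
-- + 9,2).
blowup-arcs : ∀ m → sum (λ u → count (blowup m u)) + 2 ≡ (m + 8) C 2
blowup-arcs zero = refl
blowup-arcs (suc m) = begin
  count (blowup (suc m) zero) + sum (λ u → count (blowup (suc m) (suc u))) + 2
    ≡⟨ cong₂ (λ a b → a + b + 2) (sum-colour m (λ c → [ T? (core⁺ 8F c) ]))
         (trans (∑-distrib-+ (λ u → [ T? (core (colour m u) 8F) ]) (λ u → count (blowup m u)))
                (cong (_+ sum (λ u → count (blowup m u)))
                  (sum-colour m (λ c → [ T? (core c 8F) ])))) ⟩
  m * 1 + 7 + (m * 0 + 1 + sum (λ u → count (blowup m u))) + 2
    ≡⟨ arith m (sum (λ u → count (blowup m u))) ⟩
  m + 8 + (sum (λ u → count (blowup m u)) + 2)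
    ≡⟨ cong (m + 8 +_) (blowup-arcs m) ⟩
  m + 8 + (m + 8) C 2
    ≡⟨ pascal (m + 8) ⟩
  suc (m + 8) C 2 ∎
  where
  open ≡-Reasoning
  arith : ∀ m s → m * 1 + 7 + (m * 0 + 1 + s) + 2 ≡ m + 8 + (s + 2)
  arith m s = solve (m ∷ s ∷ [])

extremal : ∀ m → ∃ λ (D : Digraph (m + 9)) → InFamily 3 2 1 D × Digraph.∣A∣ D ≡
    ((m + 9 ∸ 1) C 2) ∸ 2
extremal m = Blowup m , record
  { free   = blowup-free m
  ; strong = blowup-strong m
  ; minOut = λ v → subst (2 ≤_) (sym (outDegree-count (Blowup m) v)) (blowup-out m v)
  ; minIn  = λ v → subst (1 ≤_) (sym (inDegree-count (Blowup m) v)) (blowup-in m v) } ,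
  trans (∣A∣-sum (Blowup m)) (trans (sym (m+n∸n≡m _ 2)) (cong (_∸ 2)
    (trans (blowup-arcs m) (cong (_C 2) (sym (+-∸-assoc m {9} {1} (s≤s z≤n)))))))

theorem1p6 : ∀ (n : ℕ) → n ≥ 10 → φ[ n , 3 ]⟨ 2 , 1 ⟩≡ (((n ∸ 1) C 2) ∸ 2)
theorem1p6 n n≥10 = inj₁
  ( subst (λ n → ∃ λ (D : Digraph n) → InFamily 3 2 1 D × Digraph.∣A∣ D ≡ ((n ∸ 1) C 2) ∸ 2)
      (m∸n+n≡m (≤-trans (n≤1+n 9) n≥10)) (extremal (n ∸ 9))
  , λ D fam → arcs-bound D fam n≥10 )
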